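{- The problem Uniform Cluster Edge Editing (UCEE), parameterized by the solution size $k$, admits a kernel with $\mathcal{O}(k^2)$ vertices.
   Context: All graphs are finite, simple and undirected. A uniform cluster graph is a graph that is a disjoint union of cliques, all of the same size. UCEE: Input: a graph $G=(V,E)$ and a positive integer $k$. Question: is there a set $F\subseteq\binom{V}{2}$ with $|F|\le k$ such that $G\triangle F=(V,E\triangle F)$ is a uniform cluster graph? Here $E\triangle F$ is the symmetric difference. A kernel with $f(k)$ vertices for a parameterized graph problem is a polynomial-time algorithm that maps every instance $(G,k)$ to an instance $(G',k')$ of the same problem such that $(G,k)$ is a yes-instance if and only if $(G',k')$ is a yes-instance, $|V(G')|\le f(k)$, and $k'$ is bounded by a computable function of $k$. -}

module Defs where

open import Data.Bool.Base using (Bool; true; false; _∧_; _xor_)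
open import Data.Fin.Base using (Fin; toℕ)
open import Data.Fin.Properties using (_≟_)
open import Data.List.Base
  using (List; length; foldr; map; filter; filterᵇ; allFin; cartesianProduct)
open import Data.Nat.Base
  using (ℕ; zero; suc; _+_; _*_; _^_; _≤_; _<ᵇ_; NonZero)
open import Data.Product.Base using (_×_; _,_; ∃-syntax)
open import Function.Bundles using (_⇔_)
open import Relation.Binary.PropositionalEquality
  using (_≡_; _≢_; cong₂)

------------------------------------------------------------------------
-- Graphs

-- A set of two-element subsets of Fin n, given by its symmetric
-- and loopless characteristic function.
record PairSet (n : ℕ) : Set where
  field
    mem    : Fin n → Fin n → Bool
    sym    : ∀ u v → mem u v ≡ mem v u
    irrefl : ∀ v → mem v v ≡ false

open PairSet public

-- Each unordered pair is counted once, at its representative with u < v.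
∣_∣ : ∀ {n} → PairSet n → ℕ
∣_∣ {n} F =
  length (filterᵇ (λ (u , v) → (toℕ u <ᵇ toℕ v) ∧ mem F u v)
                  (cartesianProduct (allFin n) (allFin n)))

_△_ : ∀ {n} → PairSet n → PairSet n → PairSet n
(E △ F) .mem u v  = mem E u v xor mem F u v
(E △ F) .sym u v  = cong₂ _xor_ (sym E u v) (sym F u v)
(E △ F) .irrefl v = cong₂ _xor_ (irrefl E v) (irrefl F v)

record Graph : Set where
  constructor graph
  field
    order : ℕ
    edges : PairSet order

open Graph public

-- The vertices are split into r classes of s vertices each, and the edges
-- are exactly the pairs of distinct vertices in a common class.
record IsUniformCluster {n : ℕ} (E : PairSet n) : Set where
  field
    r s       : ℕ
    class     : Fin n → Fin r
    uniform   : ∀ i → length (filter (λ v → class v ≟ i) (allFin n)) ≡ s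
    adjacency : ∀ u v → mem E u v ≡ true ⇔ (u ≢ v × class u ≡ class v)

record Instance : Set where
  constructor _,,_
  field
    input             : Graph
    param             : ℕ
    {{param-positive}} : NonZero param

open Instance public

ParameterizedGraphProblem : Set₁
ParameterizedGraphProblem = Instance → Set

UCEE : ParameterizedGraphProblem
UCEE I = ∃[ F ] ∣ F ∣ ≤ param I × IsUniformCluster (edges (input I) △ F)

------------------------------------------------------------------------
-- Model of computation: programs over binary trees with while loops, in
-- the style of Jones' WHILE language (Computability and Complexity from a
-- Programming Perspective, 1997).

data Tree : Set where
  leaf : Tree
  node : Tree → Tree → Tree

size : Tree → ℕ
size leaf       = 1
size (node x y) = suc (size x + size y)

head : Tree → Tree
head leaf       = leaf
head (node x y) = x

tail : Tree → Tree
tail leaf       = leaf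
tail (node x y) = y

infixr 5 _⨾_

data Prog : Set where
  copy nil hd tl : Prog
  _⨾_            : Prog → Prog → Prog
  pair           : Prog → Prog → Prog
  if_then_else_  : Prog → Prog → Prog → Prog
  while_loop_    : Prog → Prog → Prog

infix 4 _⊢_⇓_∣_

-- p ⊢ x ⇓ y ∣ t : on input x, the program p halts with output y in time t.
-- Tests read leaf as false and any node as true.  Every elementary step is
-- charged the size of the tree it acts on, not 1: otherwise iterating
-- pair copy copy would build a tree of size 2^t in time O(t).  With this
-- charge the output is never larger than the time, and time agrees with
-- that of multitape Turing machines up to a polynomial.
data _⊢_⇓_∣_ : Prog → Tree → Tree → ℕ → Set where
  ⇓copy  : ∀ {x} → copy ⊢ x ⇓ x ∣ size x
  ⇓nil   : ∀ {x} → nil ⊢ x ⇓ leaf ∣ size x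
  ⇓hd    : ∀ {x} → hd ⊢ x ⇓ head x ∣ size x
  ⇓tl    : ∀ {x} → tl ⊢ x ⇓ tail x ∣ size x
  ⇓⨾     : ∀ {p q x y z t u} →
           p ⊢ x ⇓ y ∣ t → q ⊢ y ⇓ z ∣ u →
           p ⨾ q ⊢ x ⇓ z ∣ t + u
  ⇓pair  : ∀ {p q x y z t u} →
           p ⊢ x ⇓ y ∣ t → q ⊢ x ⇓ z ∣ u →
           pair p q ⊢ x ⇓ node y z ∣ size x + t + u
  ⇓then  : ∀ {c p q x a b y t u} →
           c ⊢ x ⇓ node a b ∣ t → p ⊢ x ⇓ y ∣ u →
           if c then p else q ⊢ x ⇓ y ∣ size x + t + u
  ⇓else  : ∀ {c p q x y t u} →
           c ⊢ x ⇓ leaf ∣ t → q ⊢ x ⇓ y ∣ u →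
           if c then p else q ⊢ x ⇓ y ∣ size x + t + u
  ⇓stop  : ∀ {c p x t} →
           c ⊢ x ⇓ leaf ∣ t →
           while c loop p ⊢ x ⇓ x ∣ size x + t
  ⇓again : ∀ {c p x a b y z t u v} →
           c ⊢ x ⇓ node a b ∣ t → p ⊢ x ⇓ y ∣ u →
           while c loop p ⊢ y ⇓ z ∣ v →
           while c loop p ⊢ x ⇓ z ∣ size x + t + u + v

encodeBool : Bool → Tree
encodeBool false = leaf
encodeBool true  = node leaf leaf

encodeℕ : ℕ → Tree
encodeℕ zero    = leaf
encodeℕ (suc n) = node leaf (encodeℕ n)

encodeList : List Tree → Tree
encodeList = foldr node leaf

-- The adjacency matrix, as a list of rows.
encodeGraph : Graph → Tree
encodeGraph (graph n E) =
  encodeList (map (λ u → encodeList (map (λ v → encodeBool (mem E u v))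
                                         (allFin n)))
                  (allFin n))

-- The parameter is written in unary, so that the size of an instance (G , k)
-- is the size of G plus k, as is usual in parameterized complexity.
encodeInstance : Instance → Tree
encodeInstance I = node (encodeGraph (input I)) (encodeℕ (param I))

Computable : (ℕ → ℕ) → Set
Computable g = ∃[ p ] ∀ n → ∃[ t ] p ⊢ encodeℕ n ⇓ encodeℕ (g n) ∣ t

PolynomialTime : {A B : Set} → (A → Tree) → (B → Tree) → (A → B) → Set
PolynomialTime encodeA encodeB f =
  ∃[ p ] ∃[ c ] ∃[ d ] ∀ a → ∃[ t ]
    p ⊢ encodeA a ⇓ encodeB (f a) ∣ t × t ≤ c * size (encodeA a) ^ d

------------------------------------------------------------------------
-- Kernels

record Kernel (Q : ParameterizedGraphProblem) (f : ℕ → ℕ) : Set where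
  field
    reduce           : Instance → Instance
    polynomial-time  : PolynomialTime encodeInstance encodeInstance reduce
    correct          : ∀ I → Q I ⇔ Q (reduce I)
    order-bound      : ∀ I → order (input (reduce I)) ≤ f (param I)
    g                : ℕ → ℕ
    g-computable     : Computable g
    param-bound      : ∀ I → param (reduce I) ≤ g (param I)

infix 4 _∈O_

_∈O_ : (ℕ → ℕ) → (ℕ → ℕ) → Set
f ∈O h = ∃[ c ] ∃[ k₀ ] ∀ k → k₀ ≤ k → f k ≤ c * h k

{-# OPTIONS --safe #-}

-- Let K = 2k, so that a solution with at most k edits touches at most K
-- vertices, and let s be the size of its clusters.  If s > K, two vertices are
-- in the same cluster exactly if their closed neighbourhoods differ in at most
-- K places, which leaves a single candidate to be tested.  If s ≤ K, at most
-- K * s vertices share a cluster with a touched vertex, and all the others lie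
-- in isolated cliques of size s.  Among more than 2K vertices in isolated
-- cliques of a common size z ≤ K, one clique can be deleted: some vertex of
-- these cliques is untouched, hence s = z, and an automorphism swaps the clique
-- to be deleted with an untouched one.  When no such deletion is left, either
-- at most K² + 2K vertices remain, or s > K, or there is no solution.

module Submission where

open import Data.Bool.Base as Bool using (Bool; true; false; not; _∧_; _∨_; _xor_; T)
open import Data.Bool.Properties
  using (∧-conicalˡ; ∧-conicalʳ; ∧-assoc; ∧-identityʳ; ∧-zeroʳ; xor-comm; xor-same; if-float; ¬-not)
open import Data.Fin.Base using (Fin; zero; suc; punchIn; toℕ)
open import Data.Fin.Permutation as Perm
  using (Permutation′; _⟨$⟩ʳ_; _⟨$⟩ˡ_; inverseʳ; insert; insert-punchIn)
import Data.Fin.Properties as Fin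
open import Data.List.Base as List using (List; []; _∷_; length; filterᵇ; allFin; _ʳ++_)
open import Data.List.Membership.Propositional using (_∈_)
open import Data.List.Membership.Propositional.Properties using (∈-filter⁺; ∈-filter⁻; ∈-lookup; ∈-allFin)
open import Data.List.Properties
  using ( applyUpTo-∷ʳ; filter-++; filter-all; length-++; length-map; length-tabulate; map-cong; map-id
        ; map-tabulate; map-∘; reverse-involutive; tabulate-lookup; ++-assoc; ++-identityʳ)
import Data.List.Relation.Unary.All as All
open import Data.List.Relation.Unary.AllPairs using (_∷_)
open import Data.List.Relation.Unary.Any using (index)
open import Data.List.Relation.Unary.Any.Properties using (lookup-index)
open import Data.List.Relation.Unary.Unique.Propositional using (Unique)
open import Data.List.Relation.Unary.Unique.Propositional.Properties using (filter⁺; allFin⁺)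
open import Data.Nat.Base
import Data.Nat.ListAction as ListAction
open import Data.Nat.Properties
open import Data.Nat.Solver using (module +-*-Solver)
open import Data.Product.Base using (∃-syntax; _×_; _,_; proj₁; proj₂)
open import Data.Sum.Base using (_⊎_; inj₁; inj₂)
open import Defs
open import Function.Base using (_∘_; id)
open import Function.Bundles using (_⇔_; mk⇔; Equivalence)
open import Function.Construct.Composition using (_⇔-∘_)
open import Function.Construct.Identity using (⇔-id)
open import Relation.Binary.PropositionalEquality as ≡
  using (_≡_; _≢_; _≗_; refl; cong; cong₂; subst)
open import Relation.Nullary using (Dec; does; yes; no; contradiction; ¬_)
open import Relation.Nullary.Decidable using (dec-true; dec-false; T?)
open import Algebra.Properties.CommutativeMonoid.Sum +-0-commutativeMonoid
  using (sum; sum-cong-≗; ∑-distrib-+; ∑-comm; sum-permute; sum-remove)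
open import Algebra.Properties.Semiring.Sum +-*-semiring using (*-distribʳ-sum)

-- Polynomials with natural coefficients

-- The cluster size s is hidden from the algorithm, so the deletion rule may only look at degrees;
-- untouched vertices reveal s, since their closed degree is s. The threshold 2K, rather than K,
-- serves the converse direction: the deleted clique takes away at most K of the peers, and among
-- the more than K that stay an untouched one forces s = z in every solution of the smaller graph,
-- so that the clique fits back in. Edits are counted as ordered pairs, once from each end. Hence K
-- bounds the total cost, the number of touched vertices, and the edits in any two distinct rows
-- together. The last bound settles s > K: rows of one cluster differ in at most K places, rows of
-- different clusters in at least 2s - K > K. Deletions are recorded as masks on a fixed vertex set,
-- and a solution is constrained only on the mask; vertices are renumbered once, at the end. For the
-- running time, programs are assembled from combinators that carry polynomial bounds. The delicate
-- one is the loop: its accumulator may grow only by an amount independent of its own size, as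
-- repeated doubling would otherwise be allowed.

infixl 6 _⊕_
infixl 7 _⊗_

data Poly : Set where
  X       : Poly
  con     : ℕ → Poly
  _⊕_ _⊗_ : Poly → Poly → Poly

⟦_⟧ : Poly → ℕ → ℕ
⟦ X ⟧     n = n
⟦ con c ⟧ n = c
⟦ p ⊕ q ⟧ n = ⟦ p ⟧ n + ⟦ q ⟧ n
⟦ p ⊗ q ⟧ n = ⟦ p ⟧ n * ⟦ q ⟧ n

_[_] : Poly → Poly → Poly
X       [ r ] = r
con c   [ r ] = con c
(p ⊕ q) [ r ] = p [ r ] ⊕ q [ r ]
(p ⊗ q) [ r ] = p [ r ] ⊗ q [ r ]

⟦⟧-[] : ∀ p r n → ⟦ p [ r ] ⟧ n ≡ ⟦ p ⟧ (⟦ r ⟧ n)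
⟦⟧-[] X       r n = refl
⟦⟧-[] (con c) r n = refl
⟦⟧-[] (p ⊕ q) r n = cong₂ _+_ (⟦⟧-[] p r n) (⟦⟧-[] q r n)
⟦⟧-[] (p ⊗ q) r n = cong₂ _*_ (⟦⟧-[] p r n) (⟦⟧-[] q r n)

⟦⟧-mono : ∀ p {m n} → m ≤ n → ⟦ p ⟧ m ≤ ⟦ p ⟧ n
⟦⟧-mono X       m≤n = m≤n
⟦⟧-mono (con c) m≤n = ≤-refl
⟦⟧-mono (p ⊕ q) m≤n = +-mono-≤ (⟦⟧-mono p m≤n) (⟦⟧-mono q m≤n)
⟦⟧-mono (p ⊗ q) m≤n = *-mono-≤ (⟦⟧-mono p m≤n) (⟦⟧-mono q m≤n)

-- For n ≥ 1 a larger exponent never gives a smaller power, so d + d′ serves for sums as well as for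
-- products.
⟦⟧-monomial : ∀ p → ∃[ c ] ∃[ d ] ∀ n → 1 ≤ n → ⟦ p ⟧ n ≤ c * n ^ d
⟦⟧-monomial X       = 1 , 1 , λ n _ → ≤-reflexive (≡.sym (≡.trans (*-identityˡ _) (*-identityʳ n)))
⟦⟧-monomial (con c) = c , 0 , λ n _ → ≤-reflexive (≡.sym (*-identityʳ c))
⟦⟧-monomial (p ⊕ q) with ⟦⟧-monomial p | ⟦⟧-monomial q
... | c , d , p≤ | c′ , d′ , q≤ = c + c′ , d + d′ , λ n 1≤n →
  let instance _ = >-nonZero 1≤n
      open ≤-Reasoning
  in begin
    ⟦ p ⟧ n + ⟦ q ⟧ n                    ≤⟨ +-mono-≤ (p≤ n 1≤n) (q≤ n 1≤n) ⟩
    c * n ^ d + c′ * n ^ d′              ≤⟨ +-mono-≤ (*-monoʳ-≤ c (^-monoʳ-≤ n (m≤m+n d d′)))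
                                                     (*-monoʳ-≤ c′ (^-monoʳ-≤ n (m≤n+m d′ d))) ⟩
    c * n ^ (d + d′) + c′ * n ^ (d + d′) ≡⟨ *-distribʳ-+ (n ^ (d + d′)) c c′ ⟨
    (c + c′) * n ^ (d + d′)              ∎
⟦⟧-monomial (p ⊗ q) with ⟦⟧-monomial p | ⟦⟧-monomial q
... | c , d , p≤ | c′ , d′ , q≤ = c * c′ , d + d′ , λ n 1≤n →
  let open ≤-Reasoning in begin
    ⟦ p ⟧ n * ⟦ q ⟧ n           ≤⟨ *-mono-≤ (p≤ n 1≤n) (q≤ n 1≤n) ⟩
    c * n ^ d * (c′ * n ^ d′)   ≡⟨ [m*n]*[o*p]≡[m*o]*[n*p] c (n ^ d) c′ (n ^ d′) ⟩
    c * c′ * (n ^ d * n ^ d′)   ≡⟨ cong (c * c′ *_) (^-distribˡ-+-* n d d′) ⟨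
    c * c′ * n ^ (d + d′)       ∎

-- Polynomial-time functions on trees

size≥1 : ∀ x → 1 ≤ size x
size≥1 leaf       = s≤s z≤n
size≥1 (node _ _) = s≤s z≤n

size-head : ∀ x → size (head x) ≤ size x
size-head leaf       = ≤-refl
size-head (node x y) = m≤n⇒m≤1+n (m≤m+n (size x) (size y))

size-tail : ∀ x → size (tail x) ≤ size x
size-tail leaf       = ≤-refl
size-tail (node x y) = m≤n⇒m≤1+n (m≤n+m (size y) (size x))

-- Every step is charged at least the size of what it produces. A time bound is therefore also a
-- bound on the output, and composition needs no separate size analysis.
size-output : ∀ {p x y t} → p ⊢ x ⇓ y ∣ t → size y ≤ t
size-output ⇓copy = ≤-refl
size-output (⇓nil {x}) = size≥1 x
size-output (⇓hd {x}) = size-head x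
size-output (⇓tl {x}) = size-tail x
size-output (⇓⨾ {t = t} _ q⇓) = ≤-trans (size-output q⇓) (m≤n+m _ t)
size-output (⇓pair {x = x} p⇓ q⇓) = +-mono-≤ (+-mono-≤ (size≥1 x) (size-output p⇓)) (size-output q⇓)
size-output (⇓then {x = x} {t = t} _ p⇓) = ≤-trans (size-output p⇓) (m≤n+m _ (size x + t))
size-output (⇓else {x = x} {t = t} _ q⇓) = ≤-trans (size-output q⇓) (m≤n+m _ (size x + t))
size-output (⇓stop {x = x} _) = m≤m+n (size x) _
size-output (⇓again {x = x} {t = t} {u = u} _ _ r⇓) = ≤-trans (size-output r⇓) (m≤n+m _ (size x + t + u))

-- The cost is a syntactic polynomial: it can be substituted into another one, and its values are
-- monotone, so the cost of a second program may be evaluated at a mere bound on the size of its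
-- input.
record PolyTime (f : Tree → Tree) : Set where
  constructor polyTime
  field
    prog : Prog
    cost : Poly
    runs : ∀ x → ∃[ t ] prog ⊢ x ⇓ f x ∣ t × t ≤ ⟦ cost ⟧ (size x)

  size≤ : ∀ x → size (f x) ≤ ⟦ cost ⟧ (size x)
  size≤ x = ≤-trans (size-output (proj₁ (proj₂ (runs x)))) (proj₂ (proj₂ (runs x)))

open PolyTime

idP : PolyTime (λ x → x)
idP = polyTime copy X λ x → _ , ⇓copy , ≤-refl

headP : PolyTime head
headP = polyTime hd X λ x → _ , ⇓hd , ≤-refl

tailP : PolyTime tail
tailP = polyTime tl X λ x → _ , ⇓tl , ≤-refl

_∘P_ : ∀ {g f} → PolyTime g → PolyTime f → PolyTime (λ x → g (f x))
G ∘P F = polyTime (prog F ⨾ prog G) (cost F ⊕ cost G [ cost F ]) λ x →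
  let t , F⇓ , t≤ = runs F x
      u , G⇓ , u≤ = runs G _
  in t + u , ⇓⨾ F⇓ G⇓ , +-mono-≤ t≤
       (≤-trans u≤ (≤-trans (⟦⟧-mono (cost G) (size≤ F x))
                            (≤-reflexive (≡.sym (⟦⟧-[] (cost G) (cost F) (size x))))))

leafP : PolyTime (λ _ → leaf)
leafP = polyTime nil X λ x → _ , ⇓nil , ≤-refl

nodeP : ∀ {f g} → PolyTime f → PolyTime g → PolyTime (λ x → node (f x) (g x))
nodeP F G = polyTime (pair (prog F) (prog G)) (X ⊕ cost F ⊕ cost G) λ x →
  let t , F⇓ , t≤ = runs F x
      u , G⇓ , u≤ = runs G x
  in _ , ⇓pair F⇓ G⇓ , +-mono-≤ (+-monoʳ-≤ (size x) t≤) u≤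

constP : ∀ c → PolyTime (λ _ → c)
constP leaf       = leafP
constP (node x y) = nodeP (constP x) (constP y)

caseT : Tree → Tree → Tree → Tree
caseT leaf       y z = z
caseT (node _ _) y z = y

caseP : ∀ {c f g} → PolyTime c → PolyTime f → PolyTime g → PolyTime (λ x → caseT (c x) (f x) (g x))
caseP {c} {f} {g} C F G = polyTime (if prog C then prog F else prog G) (X ⊕ cost C ⊕ (cost F ⊕ cost G)) run
  where
  run : ∀ x → ∃[ t ] (if prog C then prog F else prog G) ⊢ x ⇓ caseT (c x) (f x) (g x) ∣ t
                   × t ≤ ⟦ X ⊕ cost C ⊕ (cost F ⊕ cost G) ⟧ (size x)
  run x with c x | runs C x
  ... | node _ _ | t , C⇓ , t≤ =
    let u , F⇓ , u≤ = runs F x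
    in _ , ⇓then C⇓ F⇓ , +-mono-≤ (+-monoʳ-≤ (size x) t≤) (m≤n⇒m≤n+o _ u≤)
  ... | leaf     | t , C⇓ , t≤ =
    let u , G⇓ , u≤ = runs G x
    in _ , ⇓else C⇓ G⇓ , +-mono-≤ (+-monoʳ-≤ (size x) t≤) (m≤n⇒m≤o+n _ u≤)

-- A left fold that passes to its step each nonempty suffix of the list, so
-- that the position of the current element is available too.
foldTails : (Tree → Tree → Tree) → Tree → Tree → Tree
foldTails f acc leaf          = acc
foldTails f acc (node x xs) = foldTails f (f (node x xs) acc) xs

spine : Tree → ℕ
spine leaf       = 0
spine (node _ y) = suc (spine y)

spine≤size : ∀ x → spine x ≤ size x
spine≤size leaf       = z≤n
spine≤size (node x y) = s≤s (≤-trans (spine≤size y) (m≤n+m (size y) (size x)))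

-- The loop state is the triple of the remaining list, the accumulator and the environment `ρ`,
-- which is carried along because a program sees a single tree. In `step-growth` the increment
-- depends on the list and on `ρ` but not on the accumulator; this keeps the states polynomial over
-- polynomially many rounds.
module _ {xs init : Tree → Tree} {step : Tree → Tree → Tree → Tree} (growth : Poly)
         (XS : PolyTime xs) (INIT : PolyTime init)
         (STEP : PolyTime (λ e → step (head e) (head (tail e)) (tail (tail e))))
         (step-growth : ∀ t acc ρ → size (step t acc ρ) ≤ size acc + ⟦ growth ⟧ (size t + size ρ))
  where

  private
    BODY : PolyTime _
    BODY = nodeP (tailP ∘P headP) (nodeP STEP (tailP ∘P tailP))

    START : PolyTime (λ ρ → node (xs ρ) (node (init ρ) ρ))
    START = nodeP XS (nodeP INIT idP)

    loop : Prog
    loop = while hd loop prog BODY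

    -- The number `a` bounds the accumulator together with all growth still to come, a quantity that
    -- no round increases. Hence `s` bounds every state, and each round costs at most the same
    -- amount; the extra round in `suc (spine ts)` pays for the final failing test.
    loop-runs : ∀ ts acc ρ x a → let s = suc (x + suc (a + size ρ)) in
                size ts ≤ x → size acc + spine ts * ⟦ growth ⟧ (x + size ρ) ≤ a →
                ∃[ t ] loop ⊢ node ts (node acc ρ) ⇓ node leaf (node (foldTails (λ t acc → step t acc ρ) acc ts) ρ) ∣ t
                     × t ≤ suc (spine ts) * (s + s + ⟦ cost BODY ⟧ s)
    loop-runs leaf acc ρ x a ts≤x acc≤a = _ , ⇓stop ⇓hd , m≤n⇒m≤n+o 0 (m≤n⇒m≤n+o _ (+-mono-≤ st≤s st≤s))
      where
      st≤s : size (node leaf (node acc ρ)) ≤ suc (x + suc (a + size ρ))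
      st≤s = s≤s (+-mono-≤ ts≤x (s≤s (+-monoˡ-≤ (size ρ) (m+n≤o⇒m≤o (size acc) acc≤a))))
    loop-runs ts@(node t ts′) acc ρ x a ts≤x acc≤a =
      let u , BODY⇓ , u≤ = runs BODY (node ts (node acc ρ))
          v , loop⇓ , v≤ = loop-runs ts′ (step ts acc ρ) ρ x a (≤-trans (size-tail ts) ts≤x) acc′≤a
      in _ , ⇓again ⇓hd BODY⇓ loop⇓
         , +-mono-≤ (+-mono-≤ (+-mono-≤ st≤s st≤s) (≤-trans u≤ (⟦⟧-mono (cost BODY) st≤s))) v≤
      where
      st≤s : size (node ts (node acc ρ)) ≤ suc (x + suc (a + size ρ))
      st≤s = s≤s (+-mono-≤ ts≤x (s≤s (+-monoˡ-≤ (size ρ) (m+n≤o⇒m≤o (size acc) acc≤a))))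

      g = ⟦ growth ⟧ (x + size ρ)

      acc′≤a : size (step ts acc ρ) + spine ts′ * g ≤ a
      acc′≤a = let open ≤-Reasoning in begin
        size (step ts acc ρ) + spine ts′ * g
          ≤⟨ +-monoˡ-≤ _ (step-growth ts acc ρ) ⟩
        size acc + ⟦ growth ⟧ (size ts + size ρ) + spine ts′ * g
          ≤⟨ +-monoˡ-≤ _ (+-monoʳ-≤ (size acc) (⟦⟧-mono growth (+-monoˡ-≤ (size ρ) ts≤x))) ⟩
        size acc + g + spine ts′ * g
          ≡⟨ +-assoc (size acc) g _ ⟩
        size acc + (g + spine ts′ * g)
          ≤⟨ acc≤a ⟩
        a ∎

    accCost stateCost roundCost : Poly
    accCost   = cost INIT ⊕ cost XS ⊗ growth [ cost XS ⊕ X ]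
    stateCost = con 1 ⊕ (cost XS ⊕ (con 1 ⊕ (accCost ⊕ X)))
    roundCost = stateCost ⊕ stateCost ⊕ cost BODY [ stateCost ]

    LOOP : PolyTime (λ ρ → node leaf (node (foldTails (λ t acc → step t acc ρ) (init ρ) (xs ρ)) ρ))
    LOOP = polyTime (prog START ⨾ loop) (cost START ⊕ (con 1 ⊕ cost XS) ⊗ roundCost) λ ρ →
      let t , START⇓ , t≤ = runs START ρ
          acc≤ : size (init ρ) + spine (xs ρ) * ⟦ growth ⟧ (⟦ cost XS ⟧ (size ρ) + size ρ) ≤ ⟦ accCost ⟧ (size ρ)
          acc≤ = +-mono-≤ (size≤ INIT ρ)
                   (*-mono-≤ (≤-trans (spine≤size (xs ρ)) (size≤ XS ρ))
                             (≤-reflexive (≡.sym (⟦⟧-[] growth (cost XS ⊕ X) (size ρ)))))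
          u , loop⇓ , u≤ = loop-runs (xs ρ) (init ρ) ρ (⟦ cost XS ⟧ (size ρ)) (⟦ accCost ⟧ (size ρ))
                             (size≤ XS ρ) acc≤
      in t + u , ⇓⨾ START⇓ loop⇓
         , +-mono-≤ t≤ (≤-trans u≤ (*-mono-≤ {suc (spine (xs ρ))} (s≤s (≤-trans (spine≤size (xs ρ)) (size≤ XS ρ)))
             (+-monoʳ-≤ (⟦ stateCost ⊕ stateCost ⟧ (size ρ)) (≤-reflexive (≡.sym (⟦⟧-[] (cost BODY) stateCost (size ρ)))))))

  foldTailsP : PolyTime (λ ρ → foldTails (λ t acc → step t acc ρ) (init ρ) (xs ρ))
  foldTailsP = headP ∘P (tailP ∘P LOOP)

wk : ∀ {f} → PolyTime f → PolyTime (λ e → f (tail e))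
wk F = F ∘P tailP

caseT-≤ : ∀ c {y z n} → size y ≤ n → size z ≤ n → size (caseT c y z) ≤ n
caseT-≤ leaf       y≤ z≤ = z≤
caseT-≤ (node _ _) y≤ z≤ = y≤

reverseT : Tree → Tree
reverseT = foldTails (λ t acc → node (head t) acc) leaf

reverseP : ∀ {xs} → PolyTime xs → PolyTime (λ ρ → reverseT (xs ρ))
reverseP XS = foldTailsP (con 1 ⊕ X) XS leafP (nodeP (headP ∘P headP) (headP ∘P tailP)) λ t acc ρ →
  let open ≤-Reasoning in begin
    suc (size (head t) + size acc)       ≤⟨ s≤s (+-monoˡ-≤ (size acc) (≤-trans (size-head t) (m≤m+n (size t) (size ρ)))) ⟩
    suc (size t + size ρ + size acc)     ≡⟨ +-comm (suc (size t + size ρ)) (size acc) ⟩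
    size acc + suc (size t + size ρ)     ∎

-- Loops prepend to the accumulator, whence the reversal.
filterMapTailsʳ : (c v : Tree → Tree) → Tree → Tree
filterMapTailsʳ c v = foldTails (λ t acc → caseT (c t) (node (v t) acc) acc) leaf

filterMapTailsʳP : ∀ {c v : Tree → Tree → Tree} {xs} →
                   PolyTime (λ e → c (head e) (tail e)) → PolyTime (λ e → v (head e) (tail e)) → PolyTime xs →
                   PolyTime (λ ρ → filterMapTailsʳ (λ t → c t ρ) (λ t → v t ρ) (xs ρ))
filterMapTailsʳP {c} {v} C V XS =
  foldTailsP (con 1 ⊕ cost V [ con 1 ⊕ X ]) XS leafP
    (caseP (C ∘P env) (nodeP (V ∘P env) (headP ∘P tailP)) (headP ∘P tailP)) λ t acc ρ →
  let open ≤-Reasoning in caseT-≤ (c t ρ)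
    (begin
      suc (size (v t ρ) + size acc)
        ≤⟨ s≤s (+-monoˡ-≤ (size acc) (size≤ V (node t ρ))) ⟩
      suc (⟦ cost V ⟧ (suc (size t + size ρ)) + size acc)
        ≡⟨ cong (λ m → suc (m + size acc)) (⟦⟧-[] (cost V) (con 1 ⊕ X) (size t + size ρ)) ⟨
      suc (⟦ cost V [ con 1 ⊕ X ] ⟧ (size t + size ρ) + size acc)
        ≡⟨ +-comm (suc (⟦ cost V [ con 1 ⊕ X ] ⟧ (size t + size ρ))) (size acc) ⟩
      size acc + suc (⟦ cost V [ con 1 ⊕ X ] ⟧ (size t + size ρ)) ∎)
    (m≤m+n (size acc) _)
  where
  env : PolyTime (λ e → node (head e) (tail (tail e)))
  env = nodeP headP (tailP ∘P tailP)

filterMapT : (c v : Tree → Tree) → Tree → Tree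
filterMapT c v xs = reverseT (filterMapTailsʳ (λ t → c (head t)) (λ t → v (head t)) xs)

filterMapP : ∀ {c v : Tree → Tree → Tree} {xs} →
             PolyTime (λ e → c (head e) (tail e)) → PolyTime (λ e → v (head e) (tail e)) → PolyTime xs →
             PolyTime (λ ρ → filterMapT (λ x → c x ρ) (λ x → v x ρ) (xs ρ))
filterMapP {c} {v} C V XS =
  reverseP (filterMapTailsʳP {λ t → c (head t)} {λ t → v (head t)} (C ∘P env) (V ∘P env) XS)
  where
  env : PolyTime (λ e → node (head (head e)) (tail e))
  env = nodeP (headP ∘P headP) tailP

trueT : Tree
trueT = node leaf leaf

mapT : (Tree → Tree) → Tree → Tree
mapT v = filterMapT (λ _ → trueT) v

mapP : ∀ {v : Tree → Tree → Tree} {xs} → PolyTime (λ e → v (head e) (tail e)) → PolyTime xs →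
       PolyTime (λ ρ → mapT (λ x → v x ρ) (xs ρ))
mapP {v} V XS = filterMapP {λ _ _ → trueT} {v} (constP trueT) V XS

filterT : (Tree → Tree) → Tree → Tree
filterT c = filterMapT c (λ x → x)

filterP : ∀ {c : Tree → Tree → Tree} {xs} → PolyTime (λ e → c (head e) (tail e)) → PolyTime xs →
          PolyTime (λ ρ → filterT (λ x → c x ρ) (xs ρ))
filterP {c} C XS = filterMapP {c} {λ x _ → x} C headP XS

-- Each row is named by the number of rows after it, in unary. The first row gets the largest
-- number, and since the loop prepends, the result is in ascending order without a reversal.
indicesT : Tree → Tree
indicesT = filterMapTailsʳ (λ _ → trueT) (λ t → mapT (λ _ → leaf) (tail t))

indicesP : ∀ {xs} → PolyTime xs → PolyTime (λ ρ → indicesT (xs ρ))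
indicesP XS = filterMapTailsʳP {λ _ _ → trueT} {λ t _ → mapT (λ _ → leaf) (tail t)}
                (constP trueT) (mapP {λ _ _ → leaf} leafP (tailP ∘P headP)) XS

-- Numbers are compared through the lengths of right spines, so that lists
-- may stand for their lengths.
dropT : Tree → Tree → Tree
dropT i xs = foldTails (λ _ → tail) xs i

dropP : ∀ {i xs} → PolyTime i → PolyTime xs → PolyTime (λ ρ → dropT (i ρ) (xs ρ))
dropP I XS = foldTailsP {step = λ _ acc _ → tail acc} (con 0) I XS (tailP ∘P (headP ∘P tailP))
               λ _ acc _ → ≤-trans (size-tail acc) (m≤m+n _ 0)

size-dropT : ∀ i xs → size (dropT i xs) ≤ size xs
size-dropT leaf       xs = ≤-refl
size-dropT (node _ i) xs = ≤-trans (size-dropT i (tail xs)) (size-tail xs)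

notT : Tree → Tree
notT x = caseT x leaf trueT

notP : ∀ {f} → PolyTime f → PolyTime (λ ρ → notT (f ρ))
notP F = caseP F leafP (constP trueT)

andT : Tree → Tree → Tree
andT x y = caseT x y leaf

andP : ∀ {f g} → PolyTime f → PolyTime g → PolyTime (λ ρ → andT (f ρ) (g ρ))
andP F G = caseP F G leafP

xorT : Tree → Tree → Tree
xorT x y = caseT x (notT y) y

xorP : ∀ {f g} → PolyTime f → PolyTime g → PolyTime (λ ρ → xorT (f ρ) (g ρ))
xorP F G = caseP F (notP G) G

leqT : Tree → Tree → Tree
leqT x y = notT (dropT y x)

leqP : ∀ {f g} → PolyTime f → PolyTime g → PolyTime (λ ρ → leqT (f ρ) (g ρ))
leqP F G = notP (dropP G F)

-- Subtracting `k` as many times as `k` says avoids building a square: the accumulator only shrinks,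
-- so the loop has growth 0.
minusSquareT : Tree → Tree → Tree
minusSquareT x k = foldTails (λ _ acc → dropT k acc) x k

minusSquareP : ∀ {f g} → PolyTime f → PolyTime g → PolyTime (λ ρ → minusSquareT (f ρ) (g ρ))
minusSquareP {g = g} F G =
  foldTailsP {step = λ _ acc ρ → dropT (g ρ) acc} (con 0) G F (dropP (G ∘P (tailP ∘P tailP)) (headP ∘P tailP))
    λ _ acc ρ → ≤-trans (size-dropT (g ρ) acc) (m≤m+n _ 0)

lookupT : Tree → Tree → Tree → Tree
lookupT m u v = head (dropT v (head (dropT u m)))

lookupP : ∀ {m u v} → PolyTime m → PolyTime u → PolyTime v → PolyTime (λ ρ → lookupT (m ρ) (u ρ) (v ρ))
lookupP M U V = headP ∘P dropP V (headP ∘P dropP U M)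

allT : (Tree → Tree) → Tree → Tree
allT c xs = leqT (filterT (λ x → notT (c x)) xs) leaf

allP : ∀ {c : Tree → Tree → Tree} {xs} → PolyTime (λ e → c (head e) (tail e)) → PolyTime xs →
       PolyTime (λ ρ → allT (λ x → c x ρ) (xs ρ))
allP {c} C XS = leqP (filterP {λ x ρ → notT (c x ρ)} (notP C) XS) leafP

-- The kernelization as a program

distT : (Tree → Tree → Tree) → Tree → Tree → Tree → Tree
distT r l u v = filterT (λ w → xorT (r u w) (r v w)) l

-- Isolated cliques are recognized through twins: no neighbour of `u` has a closed neighbourhood
-- different from that of `u`.
isoT : (Tree → Tree → Tree) → Tree → Tree → Tree
isoT r l u = leqT (filterT (λ w → andT (r u w) (notT (leqT (distT r l u w) leaf))) l) leaf

degT : (Tree → Tree → Tree) → Tree → Tree → Tree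
degT r l u = filterT (r u) l

PolyTime₂ : (Tree → Tree → Tree → Tree) → Set
PolyTime₂ r = ∀ {f u v} → PolyTime f → PolyTime u → PolyTime v → PolyTime (λ ρ → r (f ρ) (u ρ) (v ρ))

module _ (r : Tree → Tree → Tree → Tree) (R : PolyTime₂ r) {f l u : Tree → Tree}
         (F : PolyTime f) (L : PolyTime l) (U : PolyTime u) where

  distP : ∀ {v} → PolyTime v → PolyTime (λ ρ → distT (r (f ρ)) (l ρ) (u ρ) (v ρ))
  distP {v} V = filterP {λ w ρ → xorT (r (f ρ) (u ρ) w) (r (f ρ) (v ρ) w)}
                    (xorP (R (wk F) (wk U) headP) (R (wk F) (wk V) headP)) L

  degP : PolyTime (λ ρ → degT (r (f ρ)) (l ρ) (u ρ))
  degP = filterP {λ w ρ → r (f ρ) (u ρ) w} (R (wk F) (wk U) headP) L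

module _ (r : Tree → Tree → Tree → Tree) (R : PolyTime₂ r) {f l u : Tree → Tree}
         (F : PolyTime f) (L : PolyTime l) (U : PolyTime u) where

  isoP : PolyTime (λ ρ → isoT (r (f ρ)) (l ρ) (u ρ))
  isoP = leqP (filterP {λ w ρ → andT (r (f ρ) (u ρ) w) (notT (leqT (distT (r (f ρ)) (l ρ) (u ρ) w) leaf))}
                 (andP (R (wk F) (wk U) headP)
                       (notP (leqP (distP r R (wk F) (wk L) (wk U) headP) leafP))) L) leafP

closedT : Tree → Tree → Tree → Tree
closedT m u v = caseT (andT (leqT u v) (leqT v u)) trueT (lookupT m u v)

closedP : PolyTime₂ closedT
closedP M U V = caseP (andP (leqP U V) (leqP V U)) (constP trueT) (lookupP M U V)

-- Here `k` receives the doubled parameter K. Dropping it once from the list of peers and comparing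
-- the rest with it again tests for more than 2K peers.
reducibleT : Tree → Tree → Tree → Tree → Tree
reducibleT m k l u =
  andT (isoT (closedT m) l u)
 (andT (leqT (degT (closedT m) l u) k)
       (notT (leqT (dropT k (filterT (λ w →
          andT (isoT (closedT m) l w)
         (andT (leqT (degT (closedT m) l w) (degT (closedT m) l u))
               (leqT (degT (closedT m) l u) (degT (closedT m) l w)))) l)) k)))

module _ {m k l : Tree → Tree} (M : PolyTime m) (K : PolyTime k) (L : PolyTime l) where

  reducibleP : ∀ {u} → PolyTime u → PolyTime (λ ρ → reducibleT (m ρ) (k ρ) (l ρ) (u ρ))
  reducibleP {u} U =
    andP (isoP closedT closedP M L U) (andP (leqP (degP closedT closedP M L U) K)
    (notP (leqP (dropP K (filterP {λ w ρ →
          andT (isoT (closedT (m ρ)) (l ρ) w)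
         (andT (leqT (degT (closedT (m ρ)) (l ρ) w) (degT (closedT (m ρ)) (l ρ) (u ρ)))
               (leqT (degT (closedT (m ρ)) (l ρ) (u ρ)) (degT (closedT (m ρ)) (l ρ) w)))}
        (andP (isoP closedT closedP (wk M) (wk L) headP)
        (andP (leqP (degP closedT closedP (wk M) (wk L) headP) (degP closedT closedP (wk M) (wk L) (wk U)))
              (leqP (degP closedT closedP (wk M) (wk L) (wk U)) (degP closedT closedP (wk M) (wk L) headP)))) L)) K)))

stepFromT : Tree → Tree → Tree → Tree
stepFromT m candidates l = caseT candidates (filterT (λ v → notT (closedT m (head candidates) v)) l) l

stepT : Tree → Tree → Tree → Tree
stepT m k l = stepFromT m (filterT (reducibleT m k l) l) l

module _ {m k l : Tree → Tree} (M : PolyTime m) (K : PolyTime k) (L : PolyTime l) where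

  candidatesP : PolyTime (λ ρ → filterT (reducibleT (m ρ) (k ρ) (l ρ)) (l ρ))
  candidatesP = filterP {λ u ρ → reducibleT (m ρ) (k ρ) (l ρ) u} (reducibleP (wk M) (wk K) (wk L) headP) L

  stepP : PolyTime (λ ρ → stepT (m ρ) (k ρ) (l ρ))
  stepP = caseP candidatesP
    (filterP {λ v ρ → notT (closedT (m ρ) (head (filterT (reducibleT (m ρ) (k ρ) (l ρ)) (l ρ))) v)}
             (notP (closedP (wk M) (wk (headP ∘P candidatesP)) headP)) L) L

size-filterTailsʳ : ∀ (c : Tree → Tree) acc xs →
  size (foldTails (λ t a → caseT (c t) (node (head t) a) a) acc xs) ≤ size acc + size xs
size-filterTailsʳ c acc leaf = m≤m+n _ _
size-filterTailsʳ c acc (node x xs) =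
  ≤-trans (size-filterTailsʳ c (caseT (c (node x xs)) (node x acc) acc) xs)
  (≤-trans (+-monoˡ-≤ (size xs)
             (caseT-≤ (c (node x xs)) {node x acc} {acc} (≤-refl {suc (size x + size acc)}) (m≤n⇒m≤1+n (m≤n+m (size acc) (size x)))))
           (≤-reflexive (≡.trans (cong (λ s → suc (s + size xs)) (+-comm (size x) (size acc)))
                                 (≡.trans (cong suc (+-assoc (size acc) (size x) (size xs)))
                                          (≡.sym (+-suc (size acc) (size x + size xs)))))))

-- The filtering pass and the reversal, itself a filter with a constantly true test, each start from
-- a leaf of size 1.
size-filterT : ∀ c xs → size (filterT c xs) ≤ suc (suc (size xs))
size-filterT c xs = ≤-trans (size-filterTailsʳ (λ _ → trueT) leaf (filterMapTailsʳ (λ t → c (head t)) head xs))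
                            (s≤s (size-filterTailsʳ (λ t → c (head t)) leaf xs))

-- The bound contained in `stepP` is a polynomial in the size of the accumulator `l`, which could
-- compound from round to round; the loop in `survivorsP` requires this additive one.
size-stepT : ∀ m k l → size (stepT m k l) ≤ size l + 2
size-stepT m k l = caseT-≤ (filterT (reducibleT m k l) l)
  (≤-trans (size-filterT (λ v → notT (closedT m (head (filterT (reducibleT m k l) l)) v)) l) (≤-reflexive (+-comm 2 (size l))))
  (m≤m+n _ 2)

-- The rows of the matrix count the rounds. An effective step removes at least one vertex, so as
-- many rounds as vertices reach a fixed point.
survivorsT : Tree → Tree → Tree
survivorsT m k = foldTails (λ _ l → stepT m k l) (indicesT m) m

survivorsP : ∀ {m k} → PolyTime m → PolyTime k → PolyTime (λ ρ → survivorsT (m ρ) (k ρ))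
survivorsP {m} {k} M K = foldTailsP {step = λ _ l ρ → stepT (m ρ) (k ρ) l} (con 2) M (indicesP M)
  (stepP (M ∘P (tailP ∘P tailP)) (K ∘P (tailP ∘P tailP)) (headP ∘P tailP))
  λ _ l ρ → size-stepT (m ρ) (k ρ) l

smallT : Tree → Tree → Tree
smallT k l = leqT (dropT k (minusSquareT l k)) k

smallP : ∀ {k l} → PolyTime k → PolyTime l → PolyTime (λ ρ → smallT (k ρ) (l ρ))
smallP K L = leqP (dropP K (minusSquareP L K)) K

-- The environment of closeT is the triple of m, k and l.
closeT : Tree → Tree → Tree → Tree
closeT e u v = leqT (distT (closedT (head e)) (tail (tail e)) u v) (head (tail e))

closeP : PolyTime₂ closeT
closeP E U V = leqP (distP closedT closedP (headP ∘P E) (tailP ∘P (tailP ∘P E)) U V) (headP ∘P (tailP ∘P E))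

withinBudgetT : Tree → Tree → Tree → Tree
withinBudgetT m k l =
  leqT trueT (foldTails (λ t acc →
    dropT (filterT (λ v → xorT (closedT m (head t) v) (closeT (node m (node k l)) (head t) v)) l) acc)
    -- Starting from K + 1, a positive remainder means a cost of at most K. Starting from K,
    -- truncated subtraction would confuse a cost of exactly K with a larger one.
    (node leaf k) l)

withinBudgetP : ∀ {m k l} → PolyTime m → PolyTime k → PolyTime l → PolyTime (λ ρ → withinBudgetT (m ρ) (k ρ) (l ρ))
withinBudgetP {m} {k} {l} M K L = leqP (constP trueT)
  (foldTailsP {step = λ t acc ρ →
      dropT (filterT (λ v → xorT (closedT (m ρ) (head t) v) (closeT (node (m ρ) (node (k ρ) (l ρ))) (head t) v)) (l ρ)) acc}
    (con 0) L (nodeP leafP K)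
    (dropP (filterP {λ v e → xorT (closedT (m (tail (tail e))) (head (head e)) v)
                                  (closeT (node (m (tail (tail e))) (node (k (tail (tail e))) (l (tail (tail e))))) (head (head e)) v)}
              (xorP (closedP (wk M′) (wk (headP ∘P headP)) headP)
                    (closeP (wk (nodeP M′ (nodeP K′ L′))) (wk (headP ∘P headP)) headP)) L′)
           (headP ∘P tailP))
    λ t acc ρ → ≤-trans
      (size-dropT (filterT (λ v → xorT (closedT (m ρ) (head t) v)
                                       (closeT (node (m ρ) (node (k ρ) (l ρ))) (head t) v)) (l ρ)) acc)
      (m≤m+n _ 0))
  where
  M′ : PolyTime (λ e → m (tail (tail e)))
  M′ = M ∘P (tailP ∘P tailP)
  K′ : PolyTime (λ e → k (tail (tail e)))
  K′ = K ∘P (tailP ∘P tailP)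
  L′ : PolyTime (λ e → l (tail (tail e)))
  L′ = L ∘P (tailP ∘P tailP)

-- Closeness is reflexive and symmetric by its definition through distances. Asking that each vertex
-- have an isolated clique as its neighbourhood adds transitivity, and comparing degrees in one
-- direction for all ordered pairs makes them equal.
uniformT : Tree → Tree → Tree
uniformT e l = allT (λ u → andT (isoT (closeT e) l u)
                                (allT (λ v → leqT (degT (closeT e) l u) (degT (closeT e) l v)) l)) l

uniformP : ∀ {e l} → PolyTime e → PolyTime l → PolyTime (λ ρ → uniformT (e ρ) (l ρ))
uniformP {e} {l} E L = allP {λ u ρ → andT (isoT (closeT (e ρ)) (l ρ) u)
                                (allT (λ v → leqT (degT (closeT (e ρ)) (l ρ) u) (degT (closeT (e ρ)) (l ρ) v)) (l ρ))}
  (andP (isoP closeT closeP (wk E) (wk L) headP)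
        (allP {λ v ρ → leqT (degT (closeT (e (tail ρ))) (l (tail ρ)) (head ρ)) (degT (closeT (e (tail ρ))) (l (tail ρ)) v)}
           (leqP (degP closeT closeP (wk (wk E)) (wk (wk L)) (wk headP)) (degP closeT closeP (wk (wk E)) (wk (wk L)) headP)) (wk L)))
  L

doubleT : Tree → Tree
doubleT k = foldTails (λ _ → node leaf) k k

doubleP : ∀ {k} → PolyTime k → PolyTime (λ ρ → doubleT (k ρ))
doubleP K = foldTailsP {step = λ _ acc _ → node leaf acc} (con 2) K K (nodeP leafP (headP ∘P tailP))
              λ _ acc _ → ≤-reflexive (+-comm 2 (size acc))

submatrixT : Tree → Tree → Tree
submatrixT m l = mapT (λ u → mapT (λ v → lookupT m u v) l) l

submatrixP : ∀ {m l} → PolyTime m → PolyTime l → PolyTime (λ ρ → submatrixT (m ρ) (l ρ))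
submatrixP {m} {l} M L = mapP {λ u ρ → mapT (λ v → lookupT (m ρ) u v) (l ρ)}
  (mapP {λ v ρ → lookupT (m (tail ρ)) (head ρ) v} (lookupP (wk (wk M)) (wk headP) headP) (wk L)) L

module _ (yes no : Tree) where

  answerT : Tree → Tree → Tree → Tree → Tree
  answerT m k K l =
    caseT (smallT K l) (node (submatrixT m l) k)
   (caseT (andT (uniformT (node m (node K l)) l) (withinBudgetT m K l)) yes no)

  kernelT : Tree → Tree
  kernelT x = answerT (head x) (tail x) (doubleT (tail x)) (survivorsT (head x) (doubleT (tail x)))

  kernelP : PolyTime kernelT
  kernelP =
    caseP (smallP K L) (nodeP (submatrixP headP L) tailP)
   (caseP (andP (uniformP (nodeP headP (nodeP K L)) L) (withinBudgetP headP K L)) (constP yes) (constP no))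
    where
    K : PolyTime (λ x → doubleT (tail x))
    K = doubleP tailP
    L : PolyTime (λ x → survivorsT (head x) (doubleT (tail x)))
    L = survivorsP headP K

-- Booleans and comparisons

∧ˡ : ∀ x {y} → x ∧ y ≡ true → x ≡ true
∧ˡ x = ∧-conicalˡ x _

∧ʳ : ∀ x {y} → x ∧ y ≡ true → y ≡ true
∧ʳ x = ∧-conicalʳ x _

∧-intro : ∀ {x y} → x ≡ true → y ≡ true → x ∧ y ≡ true
∧-intro = cong₂ _∧_

bool-ext : ∀ {x y} → (x ≡ true → y ≡ true) → (y ≡ true → x ≡ true) → x ≡ y
bool-ext {true}          f g = ≡.sym (f refl)
bool-ext {false} {true}  f g = g refl
bool-ext {false} {false} f g = refl

≢true⇒false : ∀ {x} → x ≢ true → x ≡ false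
≢true⇒false = ¬-not

true≢false : ∀ {x} {A : Set} → x ≡ true → x ≡ false → A
true≢false refl ()

not-true : ∀ {x} → not x ≡ true → x ≡ false
not-true {false} _ = refl

xor-false⇒≡ : ∀ {x y} → x xor y ≡ false → x ≡ y
xor-false⇒≡ {true}  {true}  _ = refl
xor-false⇒≡ {false} {false} _ = refl

≤ᵇ-true : ∀ {m n} → (m ≤ᵇ n) ≡ true → m ≤ n
≤ᵇ-true {m} {n} p = ≤ᵇ⇒≤ m n (subst T (≡.sym p) _)

≤⇒≤ᵇ-true : ∀ {m n} → m ≤ n → (m ≤ᵇ n) ≡ true
≤⇒≤ᵇ-true {m} {n} m≤n with m ≤ᵇ n | ≤⇒≤ᵇ m≤n
... | true | _ = refl

≤ᵇ-false : ∀ {m n} → (m ≤ᵇ n) ≡ false → n < m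
≤ᵇ-false p = ≰⇒> λ m≤n → true≢false (≤⇒≤ᵇ-true m≤n) p

does-true : ∀ {A : Set} (a? : Dec A) → does a? ≡ true → A
does-true (yes a) _ = a

-- Counting

sum-mono : ∀ {n} {f g : Fin n → ℕ} → (∀ i → f i ≤ g i) → sum f ≤ sum g
sum-mono {zero}  f≤g = z≤n
sum-mono {suc n} f≤g = +-mono-≤ (f≤g zero) (sum-mono (f≤g ∘ suc))

f≤sum : ∀ {n} (f : Fin n → ℕ) i → f i ≤ sum f
f≤sum f zero    = m≤m+n (f zero) _
f≤sum f (suc i) = ≤-trans (f≤sum (f ∘ suc) i) (m≤n+m _ (f zero))

f+f≤sum : ∀ {n} (f : Fin n → ℕ) {i j} → i ≢ j → f i + f j ≤ sum f
f+f≤sum f {zero}  {zero}  i≢j = contradiction refl i≢j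
f+f≤sum f {zero}  {suc j} i≢j = +-monoʳ-≤ (f zero) (f≤sum (f ∘ suc) j)
f+f≤sum f {suc i} {zero}  i≢j = ≤-trans (≤-reflexive (+-comm (f (suc i)) (f zero)))
                                        (+-monoʳ-≤ (f zero) (f≤sum (f ∘ suc) i))
f+f≤sum f {suc i} {suc j} i≢j = ≤-trans (f+f≤sum (f ∘ suc) (i≢j ∘ cong suc)) (m≤n+m _ (f zero))

bit : Bool → ℕ
bit true  = 1
bit false = 0

bit-mono : ∀ {x y} → (x ≡ true → y ≡ true) → bit x ≤ bit y
bit-mono {true}  f rewrite f refl = ≤-refl
bit-mono {false} f = z≤n

# : ∀ {n} → (Fin n → Bool) → ℕ
# p = sum (bit ∘ p)

#-cong : ∀ {n} {p q : Fin n → Bool} → p ≗ q → # p ≡ # q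
#-cong p≗q = sum-cong-≗ (cong bit ∘ p≗q)

#-mono : ∀ {n} {p q : Fin n → Bool} → (∀ i → p i ≡ true → q i ≡ true) → # p ≤ # q
#-mono p⇒q = sum-mono (λ i → bit-mono (p⇒q i))

#-≤0 : ∀ {n} {p : Fin n → Bool} → # p ≤ 0 → ∀ i → p i ≡ false
#-≤0 {p = p} #p≤0 i with p i in eq
... | false = refl
... | true  = contradiction (≤-trans (≤-trans (≤-reflexive (≡.sym (cong bit eq))) (f≤sum (bit ∘ p) i)) #p≤0) λ ()

#-false : ∀ {n} {p : Fin n → Bool} → (∀ i → p i ≡ false) → # p ≡ 0
#-false {zero}  p≗f = refl
#-false {suc n} p≗f = cong₂ _+_ (cong bit (p≗f zero)) (#-false (p≗f ∘ suc))

#-positive : ∀ {n} {p : Fin n → Bool} i → p i ≡ true → 1 ≤ # p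
#-positive {p = p} i pi = ≤-trans (≤-reflexive (≡.sym (cong bit pi))) (f≤sum (bit ∘ p) i)

#-pigeonhole : ∀ {n} {p q : Fin n → Bool} → # q < # p → ∃[ i ] p i ≡ true × q i ≡ false
#-pigeonhole {suc n} {p} {q} #q<#p with p zero in pz | q zero in qz
... | true  | false = zero , pz , qz
... | true  | true  = let i , pi , qi = #-pigeonhole (s<s⁻¹ #q<#p) in suc i , pi , qi
... | false | false = let i , pi , qi = #-pigeonhole #q<#p in suc i , pi , qi
... | false | true  = let i , pi , qi = #-pigeonhole (<-trans (n<1+n _) #q<#p) in suc i , pi , qi

#-witness : ∀ {n} {p : Fin n → Bool} → 1 ≤ # p → ∃[ i ] p i ≡ true
#-witness {n} {p} 1≤#p =
  let i , pi , _ = #-pigeonhole {p = p} {q = λ _ → false} (subst (_< # p) (≡.sym (#-false {n} (λ _ → refl))) 1≤#p) in i , pi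

#-cover : ∀ {n} {p q r : Fin n → Bool} → (∀ i → p i ≡ true → q i ≡ true ⊎ r i ≡ true) → # p ≤ # q + # r
#-cover {n} {p} {q} {r} cover =
  ≤-trans (sum-mono pointwise) (≤-reflexive (∑-distrib-+ (bit ∘ q) (bit ∘ r)))
  where
  pointwise : ∀ i → bit (p i) ≤ bit (q i) + bit (r i)
  pointwise i with p i in pi
  ... | false = z≤n
  ... | true with cover i pi
  ...   | inj₁ qi rewrite qi = s≤s z≤n
  ...   | inj₂ ri rewrite ri = m≤n+m 1 (bit (q i))

#-strict : ∀ {n} {p q : Fin n → Bool} i → (∀ j → p j ≡ true → q j ≡ true) → q i ≡ true → p i ≡ false → # p < # q
#-strict {p = p} {q} zero    p⇒q qi pi rewrite qi | pi = s≤s (#-mono (p⇒q ∘ suc))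
#-strict {p = p} {q} (suc i) p⇒q qi pi = +-mono-≤-< (bit-mono (p⇒q zero)) (#-strict i (p⇒q ∘ suc) qi pi)

#-all : ∀ {n} → # {n} (λ _ → true) ≡ n
#-all {zero}  = refl
#-all {suc n} = cong suc (#-all {n})

any : ∀ {n} → (Fin n → Bool) → Bool
any p = 1 ≤ᵇ # p

any-intro : ∀ {n} {p : Fin n → Bool} i → p i ≡ true → any p ≡ true
any-intro i pi = ≤⇒≤ᵇ-true (#-positive i pi)

any-elim : ∀ {n} {p : Fin n → Bool} → any p ≡ true → ∃[ i ] p i ≡ true
any-elim ap = #-witness (≤ᵇ-true ap)

any-false : ∀ {n} {p : Fin n → Bool} → any p ≡ false → ∀ i → p i ≡ false
any-false ap i = ≢true⇒false λ pi → true≢false (any-intro i pi) ap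

bit-any≤# : ∀ {n} (p : Fin n → Bool) → bit (any p) ≤ # p
bit-any≤# p with # p
... | zero  = z≤n
... | suc _ = s≤s z≤n

length-filter-tabulate : ∀ {n} {A : Set} {P : A → Set} (P? : ∀ x → Dec (P x)) (f : Fin n → A) →
                         length (List.filter P? (List.tabulate f)) ≡ # (λ i → does (P? (f i)))
length-filter-tabulate {zero}  P? f = refl
length-filter-tabulate {suc n} P? f with does (P? (f zero))
... | true  = cong suc (length-filter-tabulate P? (f ∘ suc))
... | false = length-filter-tabulate P? (f ∘ suc)

sum-lookup : ∀ {A : Set} (g : A → ℕ) xs → sum (g ∘ List.lookup xs) ≡ ListAction.sum (List.map g xs)
sum-lookup g []       = refl
sum-lookup g (x ∷ xs) = cong (g x +_) (sum-lookup g xs)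

sum-filterᵇ-tabulate : ∀ {n} {A : Set} (p : A → Bool) (g : A → ℕ) (f : Fin n → A) →
                       ListAction.sum (List.map g (filterᵇ p (List.tabulate f))) ≡
                       sum (λ i → Bool.if p (f i) then g (f i) else 0)
sum-filterᵇ-tabulate {zero}  p g f = refl
sum-filterᵇ-tabulate {suc n} p g f with p (f zero)
... | true  = cong (g (f zero) +_) (sum-filterᵇ-tabulate p g (f ∘ suc))
... | false = sum-filterᵇ-tabulate p g (f ∘ suc)

filterᵇ-filterᵇ : ∀ {A : Set} (p q : A → Bool) xs → filterᵇ q (filterᵇ p xs) ≡ filterᵇ (λ x → p x ∧ q x) xs
filterᵇ-filterᵇ p q [] = refl
filterᵇ-filterᵇ p q (x ∷ xs) with p x
... | false = filterᵇ-filterᵇ p q xs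
... | true with q x
...   | true  = cong (x ∷_) (filterᵇ-filterᵇ p q xs)
...   | false = filterᵇ-filterᵇ p q xs

filterᵇ-head : ∀ {A : Set} {p : A → Bool} xs {y ys} → filterᵇ p xs ≡ y ∷ ys → p y ≡ true
filterᵇ-head {p = p} (x ∷ xs) eq with p x in px
filterᵇ-head (x ∷ xs) refl | true = px
... | false = filterᵇ-head xs eq

fibre : ∀ {n m} → (Fin n → Fin m) → Fin m → Fin n → Bool
fibre f c v = does (f v Fin.≟ c)

-- The two removed points have the same colour, so each fibre loses the same bit on both sides, and
-- this bit cancels.
fibre-removeAt : ∀ {n m} (f g : Fin (suc n) → Fin m) j → g j ≡ f zero →
                 (∀ c → # (fibre f c) ≡ # (fibre g c)) →
                 ∀ c → # (fibre (f ∘ suc) c) ≡ # (fibre (g ∘ punchIn j) c)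
fibre-removeAt f g j gj eq c = +-cancelˡ-≡ (bit (fibre f c zero)) _ _ (begin
  # (fibre f c)                                                 ≡⟨ eq c ⟩
  # (fibre g c)                                                 ≡⟨ sum-remove {i = j} (bit ∘ fibre g c) ⟩
  bit (does (g j Fin.≟ c)) + # (fibre (g ∘ punchIn j) c)        ≡⟨ cong (λ d → bit (does (d Fin.≟ c)) + # (fibre (g ∘ punchIn j) c)) gj ⟩
  bit (does (f zero Fin.≟ c)) + # (fibre (g ∘ punchIn j) c)     ∎)
  where open ≡.≡-Reasoning

-- Remove a point from f and a point of the same colour from g, and recurse.
matching : ∀ {n m} (f g : Fin n → Fin m) → (∀ c → # (fibre f c) ≡ # (fibre g c)) →
           ∃[ π ] ∀ v → g (Perm._⟨$⟩ʳ_ {n} {n} π v) ≡ f v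
matching {zero}  f g _  = Perm.id , λ ()
matching {suc n} f g eq
  with j , fj ← #-witness (subst (1 ≤_) (eq (f zero))
                  (#-positive {p = fibre f (f zero)} zero (dec-true (f zero Fin.≟ f zero) refl)))
  with gj ← does-true (g j Fin.≟ f zero) fj
  with π , gπ ← matching (f ∘ suc) (g ∘ punchIn j) (fibre-removeAt f g j gj eq)
  = insert zero j π , λ where
    zero    → gj
    (suc v) → ≡.trans (cong g (insert-punchIn zero j π v)) (gπ v)

-- Masks, isolated cliques and solutions

Mask : ℕ → Set
Mask n = Fin n → Bool

Rel₂ : ℕ → Set
Rel₂ n = Fin n → Fin n → Bool

-- Relations are reflexive (closed neighbourhoods), and A is the set of the
-- vertices that are present.
deg : ∀ {n} → Rel₂ n → Mask n → Fin n → ℕ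
deg R A u = # (λ v → A v ∧ R u v)

dist : ∀ {n} → Rel₂ n → Mask n → Fin n → Fin n → ℕ
dist R A u v = # (λ w → A w ∧ (R u w xor R v w))

-- From here on equalities are expressed through `≤ᵇ`, the comparison that the program makes, so
-- that formulas and program can be matched test by test.
iso : ∀ {n} → Rel₂ n → Mask n → Fin n → Bool
iso R A u = # (λ w → A w ∧ (R u w ∧ not (dist R A u w ≤ᵇ 0))) ≤ᵇ 0

peer : ∀ {n} → Rel₂ n → Mask n → ℕ → Fin n → Bool
peer R A z w = iso R A w ∧ ((deg R A w ≤ᵇ z) ∧ (z ≤ᵇ deg R A w))

reducible : ∀ {n} → Rel₂ n → ℕ → Mask n → Fin n → Bool
reducible R K A u =
  iso R A u ∧ ((deg R A u ≤ᵇ K) ∧ not (# (λ w → A w ∧ peer R A (deg R A u) w) ∸ K ≤ᵇ K))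

mismatch : ∀ {n} → Mask n → Rel₂ n → Rel₂ n → Fin n → Fin n → Bool
mismatch A M H u v = A u ∧ (A v ∧ (M u v xor H u v))

-- Ordered pairs are summed, so each edit counts twice; this is why the budget is K = 2k.
editCost : ∀ {n} → Mask n → Rel₂ n → Rel₂ n → ℕ
editCost A M H = sum λ u → # (mismatch A M H u)

-- The cluster relation `H` represents the solution instead of the edit set. It is arbitrary outside
-- `A`, so that deleting vertices shrinks `A` and keeps `H`.
record Solution {n} (M : Rel₂ n) (K : ℕ) (A : Mask n) (s : ℕ) (H : Rel₂ n) : Set where
  field
    H-refl  : ∀ {u} → A u ≡ true → H u u ≡ true
    H-sym   : ∀ {u v} → A u ≡ true → A v ≡ true → H u v ≡ true → H v u ≡ true
    H-trans : ∀ {u v w} → A u ≡ true → A v ≡ true → A w ≡ true →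
              H u v ≡ true → H v w ≡ true → H u w ≡ true
    uniform : ∀ {u} → A u ≡ true → deg H A u ≡ s
    cost≤   : editCost A M H ≤ K

  H-row : ∀ {u v} → A u ≡ true → A v ≡ true → H u v ≡ true → ∀ {w} → A w ≡ true → H u w ≡ H v w
  H-row Au Av uv Aw = bool-ext (λ uw → H-trans Av Au Aw (H-sym Au Av uv) uw) (λ vw → H-trans Au Av Aw uv vw)

Solvable : ∀ {n} → Rel₂ n → ℕ → Mask n → Set
Solvable M K A = ∃[ s ] ∃[ H ] Solution M K A s H

∧-congʳ-when : ∀ {a x y} → (a ≡ true → x ≡ y) → a ∧ x ≡ a ∧ y
∧-congʳ-when {true}  x≡y = x≡y refl
∧-congʳ-when {false} x≡y = refl

module _ {n} (R : Rel₂ n) (A : Mask n) where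

  iso-elim : ∀ {u w} → iso R A u ≡ true → A w ≡ true → R u w ≡ true →
             ∀ {v} → A v ≡ true → R u v ≡ R w v
  iso-elim {u} {w} isou Aw uw {v} Av with dist R A u w ≤ᵇ 0 in d
  ... | true  = xor-false⇒≡ (≡.trans (cong (_∧ (R u v xor R w v)) (≡.sym Av)) (#-≤0 (≤ᵇ-true d) v))
  ... | false = true≢false (∧-intro Aw (∧-intro uw (cong not d)))
                  (#-≤0 (≤ᵇ-true {# (λ w → A w ∧ (R u w ∧ not (dist R A u w ≤ᵇ 0)))} isou) w)

  iso-intro : ∀ {u} → (∀ {w v} → A w ≡ true → A v ≡ true → R u w ≡ true → R u v ≡ R w v) → iso R A u ≡ true
  iso-intro {u} rows = ≤⇒≤ᵇ-true (≤-reflexive (#-false λ w → ≢true⇒false λ p →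
    let Aw = ∧ˡ (A w) p
        uw = ∧ˡ (R u w) (∧ʳ (A w) p)
        zero-dist : dist R A u w ≡ 0
        zero-dist = #-false λ v → ≢true⇒false λ q →
          let Av = ∧ˡ (A v) q
          in true≢false (∧ʳ (A v) q)
               (≡.trans (cong (_xor R w v) (rows Aw Av uw)) (xor-same (R w v)))
    in true≢false (≤⇒≤ᵇ-true (≤-reflexive zero-dist)) (not-true (∧ʳ (R u w) (∧ʳ (A w) p)))))

  peer-elim : ∀ {z w} → peer R A z w ≡ true → iso R A w ≡ true × deg R A w ≡ z
  peer-elim {z} {w} p = ∧ˡ (iso R A w) p
    , ≤-antisym (≤ᵇ-true (∧ˡ (deg R A w ≤ᵇ z) (∧ʳ (iso R A w) p)))
                (≤ᵇ-true {z} (∧ʳ (deg R A w ≤ᵇ z) (∧ʳ (iso R A w) p)))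

  peer-intro : ∀ {z w} → iso R A w ≡ true → deg R A w ≡ z → peer R A z w ≡ true
  peer-intro {w = w} isow refl = ∧-intro isow (∧-intro deg≤deg deg≤deg)
    where
    deg≤deg : (deg R A w ≤ᵇ deg R A w) ≡ true
    deg≤deg = ≤⇒≤ᵇ-true {deg R A w} ≤-refl

  record Reducible (K : ℕ) (u : Fin n) : Set where
    field
      isolated  : iso R A u ≡ true
      deg≤      : deg R A u ≤ K
      manyPeers : K + K < # (λ w → A w ∧ peer R A (deg R A u) w)

  reducible-elim : ∀ {K u} → reducible R K A u ≡ true → Reducible K u
  reducible-elim {K} {u} p = record
    { isolated  = ∧ˡ (iso R A u) p
    ; deg≤      = ≤ᵇ-true (∧ˡ (deg R A u ≤ᵇ K) (∧ʳ (iso R A u) p))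
    ; manyPeers = ≰⇒> λ few → <⇒≱
        (≤ᵇ-false {# (λ w → A w ∧ peer R A (deg R A u) w) ∸ K}
          (not-true (∧ʳ (deg R A u ≤ᵇ K) (∧ʳ (iso R A u) p))))
        (m≤n+o⇒m∸n≤o _ K few)
    }

  irreducible : ∀ {K u} → reducible R K A u ≡ false → iso R A u ≡ true → deg R A u ≤ K →
                # (λ w → A w ∧ peer R A (deg R A u) w) ≤ K + K
  irreducible {K} {u} p isou deg≤K = ≮⇒≥ λ many → true≢false
    (∧-intro isou (∧-intro (≤⇒≤ᵇ-true deg≤K)
      (cong not {x = # (λ w → A w ∧ peer R A (deg R A u) w) ∸ K ≤ᵇ K}
        (≢true⇒false λ q → <⇒≱ many (≤-trans (m≤n+m∸n _ K) (+-monoʳ-≤ K (≤ᵇ-true q))))))) p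

dist-sym : ∀ {n} (R : Rel₂ n) A u v → dist R A u v ≡ dist R A v u
dist-sym R A u v = #-cong λ w → cong (A w ∧_) (xor-comm (R u w) (R v w))

dist-refl : ∀ {n} (R : Rel₂ n) A u → dist R A u u ≡ 0
dist-refl R A u = #-false λ w → ≡.trans (cong (A w ∧_) (xor-same (R u w))) (∧-zeroʳ (A w))

-- What a solution forces: touched vertices, isolated cliques, large clusters

module _ {n} (M : Rel₂ n) (K : ℕ) where

  touched : Mask n → Rel₂ n → Mask n
  touched A H u = any (mismatch A M H u)

  near : Mask n → Rel₂ n → Mask n
  near A H u = any (λ w → A u ∧ (A w ∧ (H u w ∧ touched A H w)))

  module _ {A s H} (S : Solution M K A s H) where
    open Solution S

    -- A touched vertex has at least one mismatch in its own row, and the rows add up to the cost.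
    #touched≤ : # (touched A H) ≤ K
    #touched≤ = ≤-trans (sum-mono (λ u → bit-any≤# (mismatch A M H u))) cost≤

    touched⇒present : ∀ {u} → touched A H u ≡ true → A u ≡ true
    touched⇒present {u} t = ∧ˡ (A u) (proj₂ (any-elim {p = mismatch A M H u} t))

    untouched-row : ∀ {u} → A u ≡ true → touched A H u ≡ false → ∀ {v} → A v ≡ true → M u v ≡ H u v
    untouched-row {u} Au t {v} Av = xor-false⇒≡ (≡.trans
      (≡.sym (cong₂ (λ x y → x ∧ (y ∧ (M u v xor H u v))) Au Av))
      (any-false {p = mismatch A M H u} t v))

    untouched-deg : ∀ {u} → A u ≡ true → touched A H u ≡ false → deg M A u ≡ s
    untouched-deg Au t = ≡.trans (#-cong λ v → ∧-congʳ-when (untouched-row Au t {v})) (uniform Au)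

    untouched-exists : ∀ (p : Mask n) → K < # (λ u → A u ∧ p u) →
                       ∃[ u ] A u ≡ true × p u ≡ true × touched A H u ≡ false
    untouched-exists p many =
      let u , Apu , t = #-pigeonhole {q = touched A H} (≤-<-trans #touched≤ many)
      in u , ∧ˡ (A u) {p u} Apu , ∧ʳ (A u) {p u} Apu , t

    -- Double counting of the pairs of a vertex and a touched vertex in its cluster: each of the at
    -- most K touched vertices lies in s such pairs.
    #near≤ : # (near A H) ≤ K * s
    #near≤ = begin
      # (near A H)
        ≤⟨ sum-mono (λ u → bit-any≤# (λ w → A u ∧ (A w ∧ (H u w ∧ touched A H w)))) ⟩
      sum (λ u → # (λ w → A u ∧ (A w ∧ (H u w ∧ touched A H w))))
        ≡⟨ ∑-comm (λ u w → bit (A u ∧ (A w ∧ (H u w ∧ touched A H w)))) ⟩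
      sum (λ w → # (λ u → A u ∧ (A w ∧ (H u w ∧ touched A H w))))
        ≤⟨ sum-mono cluster ⟩
      sum (λ w → bit (touched A H w) * s)
        ≡⟨ *-distribʳ-sum s (bit ∘ touched A H) ⟨
      # (touched A H) * s
        ≤⟨ *-monoˡ-≤ s #touched≤ ⟩
      K * s ∎
      where
      open ≤-Reasoning
      cluster : ∀ w → # (λ u → A u ∧ (A w ∧ (H u w ∧ touched A H w))) ≤ bit (touched A H w) * s
      cluster w with touched A H w in t
      ... | false = ≤-reflexive (#-false λ u → ≢true⇒false λ p →
                      true≢false (∧ʳ (H u w) (∧ʳ (A w) (∧ʳ (A u) p))) refl)
      ... | true  = ≤-trans (#-mono λ u p →
                      let Au = ∧ˡ (A u) p
                          uw = ∧ˡ (H u w) (∧ʳ (A w) (∧ʳ (A u) p))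
                      in ∧-intro Au (H-sym Au (touched⇒present t) uw))
                    (≤-reflexive (≡.trans (uniform (touched⇒present t)) (≡.sym (*-identityˡ s))))

    calm⇒untouched : ∀ {u} → A u ≡ true → near A H u ≡ false →
                     ∀ {w} → A w ≡ true → H u w ≡ true → touched A H w ≡ false
    calm⇒untouched {u} Au c {w} Aw uw = ≢true⇒false λ t →
      true≢false (∧-intro Au (∧-intro Aw (∧-intro uw t))) (any-false {p = λ w → A u ∧ (A w ∧ (H u w ∧ touched A H w))} c w)

    -- The whole cluster of `u` is untouched, so the rows of its members in `M` are their rows in
    -- `H`, and those coincide within a cluster.
    calm⇒iso : ∀ {u} → A u ≡ true → near A H u ≡ false → iso M A u ≡ true × deg M A u ≡ s
    calm⇒iso Au c = iso-intro M A (λ {w} {v} Aw Av uw →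
        let uw′ = ≡.trans (≡.sym (untouched-row Au tu Aw)) uw
        in ≡.trans (untouched-row Au tu Av)
             (≡.trans (H-row Au Aw uw′ Av) (≡.sym (untouched-row Aw (calm⇒untouched Au c Aw uw′) Av))))
      , untouched-deg Au tu
      where
      tu = calm⇒untouched Au c Au (H-refl Au)

    -- The vertices of `A` that are not near a touched one all lie in isolated cliques of the same
    -- size s ≤ K, so they are peers of any one among them. The irreducibility of that one caps
    -- their number at 2K.
    irreducible⇒small : s ≤ K → (∀ u → A u ≡ true → reducible M K A u ≡ false) →
                        # A ≤ K * K + (K + K)
    irreducible⇒small s≤K irr =
      ≤-trans (#-cover {q = near A H} {r = λ u → A u ∧ not (near A H u)} split)
              (+-mono-≤ (≤-trans #near≤ (*-monoʳ-≤ K s≤K)) calm≤)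
      where
      split : ∀ u → A u ≡ true → near A H u ≡ true ⊎ A u ∧ not (near A H u) ≡ true
      split u Au with near A H u
      ... | true  = inj₁ refl
      ... | false = inj₂ (∧-intro Au refl)

      calm≤ : # (λ u → A u ∧ not (near A H u)) ≤ K + K
      calm≤ with # (λ u → A u ∧ not (near A H u)) in eq
      ... | zero = z≤n
      ... | suc c =
        let u , p = #-witness {p = λ u → A u ∧ not (near A H u)} (subst (1 ≤_) (≡.sym eq) (s≤s z≤n))
            Au = ∧ˡ (A u) p
            isou , degu = calm⇒iso Au (not-true (∧ʳ (A u) p))
        in ≤-trans (≤-reflexive (≡.sym eq)) (≤-trans
             (#-mono λ v q →
               let Av = ∧ˡ (A v) q
                   isov , degv = calm⇒iso Av (not-true (∧ʳ (A v) q))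
               in ∧-intro Av (peer-intro M A isov (≡.trans degv (≡.sym degu))))
             (irreducible M A (irr u Au) isou (≤-trans (≤-reflexive degu) s≤K)))

    row+row≤ : ∀ {u v} → u ≢ v → # (mismatch A M H u) + # (mismatch A M H v) ≤ K
    row+row≤ u≢v = ≤-trans (f+f≤sum (λ u → # (mismatch A M H u)) u≢v) cost≤

    -- Where the rows of `u` and `v` in `M` differ, one of them departs from the row that they share
    -- in `H`, so the edits in the two rows pay for the distance. The two rows must be distinct to
    -- be charged to the budget together, whence the case distinction.
    same⇒close : ∀ {u v} → A u ≡ true → A v ≡ true → H u v ≡ true → dist M A u v ≤ K
    same⇒close {u} {v} Au Av uv with u Fin.≟ v
    ... | yes refl = ≤-trans (≤-reflexive (dist-refl M A u)) z≤n
    ... | no  u≢v  = ≤-trans (#-cover cover) (row+row≤ u≢v)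
      where
      cover : ∀ w → A w ∧ (M u w xor M v w) ≡ true → mismatch A M H u w ≡ true ⊎ mismatch A M H v w ≡ true
      cover w p with A w in Aw
      ... | true rewrite Au | Av | H-row Au Av uv Aw with M u w | M v w | H v w
      ... | true  | false | true  = inj₂ refl
      ... | true  | false | false = inj₁ refl
      ... | false | true  | true  = inj₁ refl
      ... | false | true  | false = inj₂ refl

    -- The clusters of `u` and `v` are disjoint and contain 2s vertices. At each of these the rows
    -- in `H` differ, so either the rows in `M` differ as well or one of the two rows has an edit
    -- there. A distance of at most K would give 2s ≤ 2K.
    different⇒far : ∀ {u v} → K < s → A u ≡ true → A v ≡ true → H u v ≡ false → K < dist M A u v
    different⇒far {u} {v} K<s Au Av uv = ≰⇒> λ close → <⇒≱ (+-mono-< K<s K<s) (begin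
      s + s
        ≡⟨ cong₂ _+_ (uniform Au) (uniform Av) ⟨
      deg H A u + deg H A v
        ≡⟨ ∑-distrib-+ (λ w → bit (A w ∧ H u w)) (λ w → bit (A w ∧ H v w)) ⟨
      sum (λ w → bit (A w ∧ H u w) + bit (A w ∧ H v w))
        ≤⟨ sum-mono pointwise ⟩
      sum (λ w → bit (A w ∧ (M u w xor M v w)) + (bit (mismatch A M H u w) + bit (mismatch A M H v w)))
        ≡⟨ ∑-distrib-+ (λ w → bit (A w ∧ (M u w xor M v w))) (λ w → bit (mismatch A M H u w) + bit (mismatch A M H v w)) ⟩
      dist M A u v + sum (λ w → bit (mismatch A M H u w) + bit (mismatch A M H v w))
        ≡⟨ cong (dist M A u v +_) (∑-distrib-+ (λ w → bit (mismatch A M H u w)) (λ w → bit (mismatch A M H v w))) ⟩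
      dist M A u v + (# (mismatch A M H u) + # (mismatch A M H v))
        ≤⟨ +-mono-≤ close (row+row≤ u≢v) ⟩
      K + K ∎)
      where
      open ≤-Reasoning
      u≢v : u ≢ v
      u≢v refl = true≢false (H-refl Au) uv

      pointwise : ∀ w → bit (A w ∧ H u w) + bit (A w ∧ H v w) ≤
                  bit (A w ∧ (M u w xor M v w)) + (bit (mismatch A M H u w) + bit (mismatch A M H v w))
      pointwise w rewrite Au | Av with A w in Aw
      ... | false = z≤n
      ... | true with H u w in uw | H v w in vw
      ...   | true  | true  = true≢false (H-trans Au Aw Av uw (H-sym Av Aw vw)) uv
      ...   | false | false = z≤n
      ...   | true  | false with M u w | M v w
      ...     | true  | true  = s≤s z≤n
      ...     | true  | false = s≤s z≤n
      ...     | false | true  = s≤s z≤n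
      ...     | false | false = s≤s z≤n
      pointwise w | true | false | true with M u w | M v w
      ...     | true  | true  = s≤s z≤n
      ...     | true  | false = s≤s z≤n
      ...     | false | true  = s≤s z≤n
      ...     | false | false = s≤s z≤n

    large⇒close : K < s → ∀ {u v} → A u ≡ true → A v ≡ true → H u v ≡ (dist M A u v ≤ᵇ K)
    large⇒close K<s {u} {v} Au Av with H u v in uv
    ... | true  = ≡.sym (≤⇒≤ᵇ-true (same⇒close Au Av uv))
    ... | false = ≡.sym (≢true⇒false λ c → <⇒≱ (different⇒far K<s Au Av uv) (≤ᵇ-true c))

-- A permutation that swaps two disjoint sets of equal size

module _ {n} {C D : Mask n} (disjoint : ∀ v → C v ≡ true → D v ≡ false) where

  private
    -- The sets `C` and `D` receive one colour each, every other vertex a colour of its own. The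
    -- colourings `before` and `after` exchange the first two colours, so a permutation that matches
    -- one with the other swaps the sets and fixes the rest.
    paint : Bool → Bool → Fin n → Fin (2 + n)
    paint c d v = Bool.if c then zero else (Bool.if d then suc zero else suc (suc v))

    before after : Fin n → Fin (2 + n)
    before v = paint (C v) (D v) v
    after  v = paint (D v) (C v) v

    same-fibres : # C ≡ # D → ∀ c → # (fibre before c) ≡ # (fibre after c)
    same-fibres C≡D zero = ≡.trans (#-cong first) (≡.trans C≡D (#-cong (≡.sym ∘ second)))
      where
      first : ∀ v → fibre before zero v ≡ C v
      first v with C v | D v
      ... | true  | _     = refl
      ... | false | true  = refl
      ... | false | false = refl
      second : ∀ v → fibre after zero v ≡ D v
      second v with C v | D v
      ... | _     | true  = refl
      ... | true  | false = refl
      ... | false | false = refl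
    same-fibres C≡D (suc zero) = ≡.trans (#-cong first) (≡.trans (≡.sym C≡D) (#-cong (≡.sym ∘ second)))
      where
      first : ∀ v → fibre before (suc zero) v ≡ D v
      first v with C v in c | D v in d
      ... | true  | true  = true≢false d (disjoint v c)
      ... | true  | false = refl
      ... | false | true  = refl
      ... | false | false = refl
      second : ∀ v → fibre after (suc zero) v ≡ C v
      second v with C v in c | D v in d
      ... | true  | true  = true≢false d (disjoint v c)
      ... | true  | false = refl
      ... | false | true  = refl
      ... | false | false = refl
    same-fibres C≡D (suc (suc c)) = #-cong other
      where
      other : ∀ v → fibre before (suc (suc c)) v ≡ fibre after (suc (suc c)) v
      other v with C v | D v
      ... | true  | true  = refl
      ... | true  | false = refl
      ... | false | true  = refl
      ... | false | false = refl

  record Swaps (π : Permutation′ n) : Set where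
    field
      C⇒D   : ∀ {v} → C v ≡ true → D (π ⟨$⟩ʳ v) ≡ true
      D⇒C   : ∀ {v} → D v ≡ true → C (π ⟨$⟩ʳ v) ≡ true
      fixed : ∀ {v} → C v ≡ false → D v ≡ false → π ⟨$⟩ʳ v ≡ v

  swap : # C ≡ # D → ∃[ π ] Swaps π
  swap C≡D with π , after∘π ← matching before after (same-fibres C≡D) = π , record
    { C⇒D   = λ {v} c → C⇒D′ v (≡.trans (after∘π v) (cong (λ x → paint x (D v) v) c))
    ; D⇒C   = λ {v} d → D⇒C′ v (≡.trans (after∘π v) (cong₂ (λ x y → paint x y v) (C-false v d) d))
    ; fixed = λ {v} c d → fixed′ v (≡.trans (after∘π v) (cong₂ (λ x y → paint x y v) c d))
    }
    where
    C-false : ∀ v → D v ≡ true → C v ≡ false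
    C-false v d = ≢true⇒false λ c → true≢false d (disjoint v c)

    C⇒D′ : ∀ v → paint (D (π ⟨$⟩ʳ v)) (C (π ⟨$⟩ʳ v)) (π ⟨$⟩ʳ v) ≡ zero → D (π ⟨$⟩ʳ v) ≡ true
    C⇒D′ v e with D (π ⟨$⟩ʳ v) | C (π ⟨$⟩ʳ v) | e
    ... | true  | _     | _  = refl
    ... | false | true  | ()
    ... | false | false | ()

    D⇒C′ : ∀ v → paint (D (π ⟨$⟩ʳ v)) (C (π ⟨$⟩ʳ v)) (π ⟨$⟩ʳ v) ≡ suc zero → C (π ⟨$⟩ʳ v) ≡ true
    D⇒C′ v e with D (π ⟨$⟩ʳ v) | C (π ⟨$⟩ʳ v) | e
    ... | false | true | _ = refl

    fixed′ : ∀ v → paint (D (π ⟨$⟩ʳ v)) (C (π ⟨$⟩ʳ v)) (π ⟨$⟩ʳ v) ≡ suc (suc v) → π ⟨$⟩ʳ v ≡ v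
    fixed′ v e with D (π ⟨$⟩ʳ v) | C (π ⟨$⟩ʳ v) | e
    ... | false | false | e′ = Fin.suc-injective (Fin.suc-injective e′)

-- Deleting and restoring an isolated clique

without : ∀ {n} → Rel₂ n → Mask n → Fin n → Mask n
without M A a v = A v ∧ not (M a v)

module _ {n} (M : Rel₂ n) (M-refl : ∀ u → M u u ≡ true) (M-sym : ∀ u v → M u v ≡ M v u) (K : ℕ) where

  -- By `row` the set that disappears is a whole cluster of `H`, so the other clusters stay complete
  -- and the cost can only fall. The cluster is given by a vertex `c` of its own, because the
  -- solution knows it through an untouched vertex and not through `a`.
  delete-cluster : ∀ {A s H a c} → Solution M K A s H → A c ≡ true →
                   (∀ {v} → A v ≡ true → H c v ≡ M a v) → Solution M K (without M A a) s H
  delete-cluster {A} {s} {H} {a} {c} S Ac row = record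
    { H-refl  = λ {u} A′u → H-refl (∧ˡ (A u) A′u)
    ; H-sym   = λ {u} {v} A′u A′v → H-sym (∧ˡ (A u) A′u) (∧ˡ (A v) A′v)
    ; H-trans = λ {u} {v} {w} A′u A′v A′w → H-trans (∧ˡ (A u) A′u) (∧ˡ (A v) A′v) (∧ˡ (A w) A′w)
    ; uniform = λ {u} A′u → ≡.trans (#-cong (same u A′u)) (uniform (∧ˡ (A u) A′u))
    ; cost≤   = ≤-trans (sum-mono λ u → #-mono λ v p →
                  ∧-intro (∧ˡ (A u) (∧ˡ (without M A a u) p))
                 (∧-intro (∧ˡ (A v) (∧ˡ (without M A a v) (∧ʳ (without M A a u) p)))
                          (∧ʳ (without M A a v) (∧ʳ (without M A a u) p)))) cost≤
    }
    where
    open Solution S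
    same : ∀ u → without M A a u ≡ true → ∀ v → without M A a v ∧ H u v ≡ A v ∧ H u v
    same u A′u v with A v in Av | M a v in av
    ... | false | _     = refl
    ... | true  | false = refl
    ... | true  | true  = ≡.sym (≢true⇒false λ uv → true≢false
      (≡.trans (≡.sym (row Au)) (H-trans Ac Av Au (≡.trans (row Av) av) (H-sym Au Av uv)))
      (not-true (∧ʳ (A u) A′u)))
      where Au = ∧ˡ (A u) A′u

  relabel : ∀ {A s H} → Solution M K A s H → (π : Permutation′ n) →
            (∀ v → A (π ⟨$⟩ʳ v) ≡ A v) →
            (∀ {u v} → A u ≡ true → A v ≡ true → M (π ⟨$⟩ʳ u) (π ⟨$⟩ʳ v) ≡ M u v) →
            Solution M K A s (λ u v → H (π ⟨$⟩ʳ u) (π ⟨$⟩ʳ v))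
  relabel {A} {s} {H} S π Aπ Mπ = record
    { H-refl  = λ Au → H-refl (A→ Au)
    ; H-sym   = λ Au Av → H-sym (A→ Au) (A→ Av)
    ; H-trans = λ Au Av Aw → H-trans (A→ Au) (A→ Av) (A→ Aw)
    ; uniform = λ {u} Au → ≡.trans
        (≡.trans (#-cong (λ v → cong (_∧ H (π ⟨$⟩ʳ u) (π ⟨$⟩ʳ v)) (≡.sym (Aπ v))))
                 (≡.sym (sum-permute (λ v → bit (A v ∧ H (π ⟨$⟩ʳ u) v)) π)))
        (uniform (A→ Au))
    ; cost≤   = ≤-trans (≤-reflexive same-cost) cost≤
    }
    where
    open Solution S
    A→ : ∀ {v} → A v ≡ true → A (π ⟨$⟩ʳ v) ≡ true
    A→ {v} = ≡.trans (Aπ v)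

    same-mismatch : ∀ u v → mismatch A M (λ u v → H (π ⟨$⟩ʳ u) (π ⟨$⟩ʳ v)) u v
                          ≡ mismatch A M H (π ⟨$⟩ʳ u) (π ⟨$⟩ʳ v)
    same-mismatch u v rewrite Aπ u | Aπ v = ∧-congʳ-when λ Au → ∧-congʳ-when λ Av →
      cong (_xor H (π ⟨$⟩ʳ u) (π ⟨$⟩ʳ v)) (≡.sym (Mπ Au Av))

    same-cost : editCost A M (λ u v → H (π ⟨$⟩ʳ u) (π ⟨$⟩ʳ v)) ≡ editCost A M H
    same-cost = ≡.trans
      (sum-cong-≗ λ u → ≡.trans (#-cong (same-mismatch u))
                                (≡.sym (sum-permute (bit ∘ mismatch A M H (π ⟨$⟩ʳ u)) π)))
      (≡.sym (sum-permute (λ u → # (mismatch A M H u)) π))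

  module _ {A : Mask n} {a} (isoa : iso M A a ≡ true) where

    clique-row : ∀ {u v} → A u ≡ true → A v ≡ true → M a u ≡ true → M u v ≡ M a v
    clique-row Au Av au = ≡.sym (iso-elim M A isoa Au au Av)

  -- The exchange argument: an automorphism swaps the isolated cliques of
  -- a and b.
  module Exchange {A : Mask n} {a b} (Aa : A a ≡ true) (Ab : A b ≡ true)
                  (isoa : iso M A a ≡ true) (isob : iso M A b ≡ true)
                  (deg≡ : deg M A a ≡ deg M A b) (ab : M a b ≡ false) where

    private
      C D : Mask n
      C v = A v ∧ M a v
      D v = A v ∧ M b v

      disjoint : ∀ v → C v ≡ true → D v ≡ false
      disjoint v c = ≢true⇒false λ d →
        let Av = ∧ˡ (A v) c
        in true≢false (≡.trans (≡.trans (≡.sym (clique-row {A = A} isoa Av Ab (∧ʳ (A v) c))) (M-sym v b)) (∧ʳ (A v) d)) ab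

    π : Permutation′ n
    π = proj₁ (swap disjoint deg≡)

    open Swaps (proj₂ (swap disjoint deg≡))

    private
      C-false : ∀ {v} → D v ≡ true → C v ≡ false
      C-false {v} d = ≢true⇒false λ c → true≢false d (disjoint v c)

    A∘π : ∀ v → A (π ⟨$⟩ʳ v) ≡ A v
    A∘π v with C v in c
    ... | true  = ≡.trans (∧ˡ (A (π ⟨$⟩ʳ v)) (C⇒D c)) (≡.sym (∧ˡ (A v) c))
    ... | false with D v in d
    ...   | true  = ≡.trans (∧ˡ (A (π ⟨$⟩ʳ v)) (D⇒C d)) (≡.sym (∧ˡ (A v) d))
    ...   | false = cong A (fixed c d)

    private
      under : ∀ {x v} → A v ≡ true → A v ∧ x ≡ false → x ≡ false
      under Av p rewrite Av = p

      A→ : ∀ {v} → A v ≡ true → A (π ⟨$⟩ʳ v) ≡ true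
      A→ {v} = ≡.trans (A∘π v)

    row-a : ∀ {v} → A v ≡ true → M b (π ⟨$⟩ʳ v) ≡ M a v
    row-a {v} Av with C v in c
    ... | true  = ≡.trans (∧ʳ (A (π ⟨$⟩ʳ v)) (C⇒D c)) (≡.sym (∧ʳ (A v) c))
    ... | false with D v in d
    ...   | true  = ≡.trans (under (A→ Av) (disjoint _ (D⇒C d))) (≡.sym (under Av c))
    ...   | false = ≡.trans (cong (M b) (fixed c d)) (≡.trans (under Av d) (≡.sym (under Av c)))

    row-b : ∀ {v} → A v ≡ true → M a (π ⟨$⟩ʳ v) ≡ M b v
    row-b {v} Av with D v in d
    ... | true  = ≡.trans (∧ʳ (A (π ⟨$⟩ʳ v)) (D⇒C d)) (≡.sym (∧ʳ (A v) d))
    ... | false with C v in c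
    ...   | true  = ≡.trans (under (A→ Av) (C-false (C⇒D c))) (≡.sym (under Av d))
    ...   | false = ≡.trans (cong (M a) (fixed c d)) (≡.trans (under Av c) (≡.sym (under Av d)))

    private
      -- Every vertex of an isolated clique has the row of its representative, so the claim reduces
      -- to the rows of `a` and `b`, which `row-a` and `row-b` carry into each other.
      moved : ∀ {u v} → A u ≡ true → A v ≡ true → C u ≡ true ⊎ D u ≡ true →
              M (π ⟨$⟩ʳ u) (π ⟨$⟩ʳ v) ≡ M u v
      moved {u} {v} Au Av (inj₁ c) =
        ≡.trans (clique-row {A = A} isob (A→ Au) (A→ Av) (∧ʳ (A (π ⟨$⟩ʳ u)) (C⇒D c)))
                (≡.trans (row-a Av) (≡.sym (clique-row {A = A} isoa Au Av (∧ʳ (A u) c))))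
      moved {u} {v} Au Av (inj₂ d) =
        ≡.trans (clique-row {A = A} isoa (A→ Au) (A→ Av) (∧ʳ (A (π ⟨$⟩ʳ u)) (D⇒C d)))
                (≡.trans (row-b Av) (≡.sym (clique-row {A = A} isob Au Av (∧ʳ (A u) d))))

      position : ∀ v → (C v ≡ true ⊎ D v ≡ true) ⊎ π ⟨$⟩ʳ v ≡ v
      position v with C v in c | D v in d
      ... | true  | _     = inj₁ (inj₁ refl)
      ... | false | true  = inj₁ (inj₂ refl)
      ... | false | false = inj₂ (fixed c d)

    automorphism : ∀ {u v} → A u ≡ true → A v ≡ true → M (π ⟨$⟩ʳ u) (π ⟨$⟩ʳ v) ≡ M u v
    automorphism {u} {v} Au Av with position u | position v
    ... | inj₁ p | _      = moved Au Av p
    ... | inj₂ _ | inj₁ q = ≡.trans (M-sym _ _) (≡.trans (moved Av Au q) (M-sym v u))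
    ... | inj₂ e | inj₂ f = cong₂ M e f

  module _ {A : Mask n} {a} (Aa : A a ≡ true) (red : reducible M K A a ≡ true) where

    private
      open Reducible (reducible-elim M A red)
      z = deg M A a

    delete-clique : Solvable M K A → Solvable M K (without M A a)
    delete-clique (s , H , S)
      with b , Ab , peerb , tb ← untouched-exists M K S (peer M A z) (≤-<-trans (m≤n+m K K) manyPeers)
      with isob , degb ← peer-elim M A peerb
      with M a b in ab
    -- The untouched peer lies in the clique of `a`, which is thus already a cluster of `H`.
    ... | true  = s , H , delete-cluster S Ab λ Av →
                    ≡.trans (≡.sym (untouched-row M K S Ab tb Av)) (clique-row {A = A} isolated Ab Av ab)
    ... | false = s , _ , delete-cluster (relabel S π A∘π automorphism) Ac λ {v} Av →
                    ≡.trans (cong (λ x → H x (π ⟨$⟩ʳ v)) πc) (≡.trans (≡.sym (untouched-row M K S Ab tb (≡.trans (A∘π _) Av))) (row-a Av))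
      where
      open Exchange Aa Ab isolated isob (≡.sym degb) ab
      -- In the relabelled solution the cluster of `c` is the preimage of the clique of `b`, which
      -- is the clique of `a`.
      c = π ⟨$⟩ˡ b
      πc : π ⟨$⟩ʳ c ≡ b
      πc = inverseʳ π
      Ac : A c ≡ true
      Ac = ≡.trans (≡.sym (A∘π c)) (≡.trans (cong A πc) Ab)

    restore-clique : Solvable M K (without M A a) → Solvable M K A
    restore-clique (s , H , S) = s , H′ , record
      { H-refl  = λ {u} Au → H′-refl u Au
      ; H-sym   = λ {u} {v} → H′-sym u v
      ; H-trans = λ {u} {v} {w} → H′-trans u v w
      ; uniform = λ {u} → H′-uniform u
      ; cost≤   = ≤-trans (sum-mono λ u → #-mono λ v → H′-cost u v) cost≤
      }
      where
      open Solution S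
      A′ = without M A a

      many : K < # (λ u → A′ u ∧ peer M A z u)
      many = +-cancelʳ-< K K _ (<-≤-trans manyPeers (≤-trans (#-cover cover) (+-monoʳ-≤ _ deg≤)))
        where
        cover : ∀ u → A u ∧ peer M A z u ≡ true →
                A′ u ∧ peer M A z u ≡ true ⊎ A u ∧ M a u ≡ true
        cover u p with A u | M a u
        ... | true | true  = inj₂ refl
        ... | true | false = inj₁ p

      -- An untouched peer that stays has degree s in what is left. It lies outside the isolated
      -- clique of `a` and so lost no neighbour with it: its degree is still z.
      s≡z : s ≡ z
      s≡z with u , A′u , peeru , tu ← untouched-exists M K S (peer M A z) many
          = ≡.trans (≡.sym (untouched-deg M K S A′u tu)) (≡.trans (#-cong same) (proj₂ (peer-elim M A peeru)))
        where
        Au = ∧ˡ (A u) A′u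
        same : ∀ v → A′ v ∧ M u v ≡ A v ∧ M u v
        same v with A v in Av | M a v in av
        ... | false | _     = refl
        ... | true  | false = refl
        ... | true  | true  = ≡.sym (≡.trans (M-sym u v) (≡.trans (clique-row {A = A} isolated Av Au av) (not-true (∧ʳ (A u) A′u))))

      -- The clique of `a` returns as a cluster of its own. The guard on `v` cuts off the values of
      -- `H` on deleted vertices, about which nothing is known.
      H′ : Rel₂ n
      H′ u v = Bool.if M a u then M a v else (not (M a v) ∧ H u v)

      outside : ∀ {u} → A u ≡ true → M a u ≡ false → A′ u ≡ true
      outside Au au = ∧-intro Au (cong not au)

      H′-refl : ∀ u → A u ≡ true → H′ u u ≡ true
      H′-refl u Au with M a u in au
      ... | true  = refl
      ... | false = H-refl (outside Au au)

      H′-sym : ∀ u v → A u ≡ true → A v ≡ true → H′ u v ≡ true → H′ v u ≡ true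
      H′-sym u v Au Av with M a u in au | M a v in av
      ... | true  | true  = λ p → refl
      ... | true  | false = λ ()
      ... | false | true  = λ ()
      ... | false | false = H-sym (outside Au au) (outside Av av)

      H′-trans : ∀ u v w → A u ≡ true → A v ≡ true → A w ≡ true → H′ u v ≡ true → H′ v w ≡ true → H′ u w ≡ true
      H′-trans u v w Au Av Aw with M a u in au | M a v in av | M a w in aw
      ... | true  | true  | _     = λ _ p → p
      ... | true  | false | _     = λ ()
      ... | false | true  | _     = λ ()
      ... | false | false | true  = λ _ ()
      ... | false | false | false = H-trans (outside Au au) (outside Av av) (outside Aw aw)

      H′-uniform : ∀ u → A u ≡ true → deg H′ A u ≡ s
      H′-uniform u Au with M a u in au
      ... | true  = ≡.sym s≡z
      ... | false = ≡.trans (#-cong λ v → ≡.sym (∧-assoc (A v) (not (M a v)) (H u v))) (uniform (outside Au au))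

      -- Since the clique is isolated in `M`, the new relation agrees with `M` inside it and between
      -- it and the rest, so restoring it adds no edit.
      H′-cost : ∀ u v → mismatch A M H′ u v ≡ true → mismatch A′ M H u v ≡ true
      H′-cost u v p with A u in Au | A v in Av
      ... | true | true with M a u in au
      ...   | true = true≢false p (≡.trans (cong (_xor M a v) (clique-row {A = A} isolated Au Av au)) (xor-same (M a v)))
      ...   | false with M a v in av
      ...     | true  = true≢false p (cong (_xor false) (≡.trans (M-sym u v) (≡.trans (clique-row {A = A} isolated Av Au av) au)))
      ...     | false = p

-- Equivalence relations as partitions

record Partition {n} (H : Rel₂ n) : Set where
  field
    r      : ℕ
    class  : Fin n → Fin r
    -- `IsUniformCluster` prescribes the size of every class, so an empty class would spoil
    -- uniformity.
    onto   : ∀ i → ∃[ u ] class u ≡ i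
    sound  : ∀ u v → class u ≡ class v → H u v ≡ true
    exact  : ∀ u v → H u v ≡ true → class u ≡ class v

-- Induction on the number of vertices: the first vertex joins the class of a later related one if
-- there is any, and opens a new class otherwise.
partition : ∀ {n} (H : Rel₂ n) → (∀ u → H u u ≡ true) → (∀ u v → H u v ≡ true → H v u ≡ true) →
            (∀ u v w → H u v ≡ true → H v w ≡ true → H u w ≡ true) → Partition H
partition {zero}  H H-refl H-sym H-trans = record
  { r = 0 ; class = λ () ; onto = λ () ; sound = λ () ; exact = λ () }
partition {suc n} H H-refl H-sym H-trans with any (λ v → H zero (suc v)) in anyv
... | true with v , 0v ← any-elim {p = λ v → H zero (suc v)} anyv = record
  { r     = r
  ; class = λ { zero → class v ; (suc u) → class u }
  ; onto  = λ i → let u , eq = onto i in suc u , eq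
  ; sound = λ where
      zero    zero    _  → H-refl zero
      zero    (suc w) eq → H-trans _ _ _ 0v (sound v w eq)
      (suc u) zero    eq → H-trans _ _ _ (sound u v eq) (H-sym _ _ 0v)
      (suc u) (suc w) eq → sound u w eq
  ; exact = λ where
      zero    zero    _  → refl
      zero    (suc w) 0w → exact v w (H-trans _ _ _ (H-sym _ _ 0v) 0w)
      (suc u) zero    u0 → exact u v (H-trans _ _ _ u0 0v)
      (suc u) (suc w) uw → exact u w uw
  }
  where open Partition (partition (λ u v → H (suc u) (suc v)) (λ u → H-refl (suc u))
                          (λ u v → H-sym (suc u) (suc v)) (λ u v w → H-trans (suc u) (suc v) (suc w)))
... | false = record
  { r     = suc r
  ; class = λ { zero → zero ; (suc u) → suc (class u) }
  ; onto  = λ { zero → zero , refl ; (suc i) → let u , eq = onto i in suc u , cong suc eq }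
  ; sound = λ where
      zero    zero    _  → H-refl zero
      (suc u) (suc w) eq → sound u w (Fin.suc-injective eq)
  ; exact = λ where
      zero    zero    _  → refl
      zero    (suc w) 0w → true≢false 0w (any-false {p = λ v → H zero (suc v)} anyv w)
      (suc u) zero    u0 → true≢false (H-sym _ _ u0) (any-false {p = λ v → H zero (suc v)} anyv u)
      (suc u) (suc w) uw → cong suc (exact u w uw)
  }
  where open Partition (partition (λ u v → H (suc u) (suc v)) (λ u → H-refl (suc u))
                          (λ u v → H-sym (suc u) (suc v)) (λ u v w → H-trans (suc u) (suc v) (suc w)))

-- Edit sets and cluster relations

length-filterᵇ-map : ∀ {A B : Set} (p : B → Bool) (f : A → B) xs →
                     length (filterᵇ p (List.map f xs)) ≡ length (filterᵇ (p ∘ f) xs)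
length-filterᵇ-map p f [] = refl
length-filterᵇ-map p f (x ∷ xs) with p (f x)
... | true  = cong suc (length-filterᵇ-map p f xs)
... | false = length-filterᵇ-map p f xs

length-filterᵇ-cartesianProduct :
  ∀ {n m} {A B : Set} (p : A × B → Bool) (f : Fin n → A) (g : Fin m → B) →
  length (filterᵇ p (List.cartesianProduct (List.tabulate f) (List.tabulate g))) ≡
  sum (λ i → # (λ j → p (f i , g j)))
length-filterᵇ-cartesianProduct {zero}  p f g = refl
length-filterᵇ-cartesianProduct {suc n} p f g = begin
  length (filterᵇ p (row List.++ rest))
    ≡⟨ cong length (filter-++ (T? ∘ p) row rest) ⟩
  length (filterᵇ p row List.++ filterᵇ p rest)
    ≡⟨ length-++ (filterᵇ p row) ⟩
  length (filterᵇ p row) + length (filterᵇ p rest)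
    ≡⟨ cong₂ _+_ (≡.trans (length-filterᵇ-map p (f zero ,_) (List.tabulate g))
                          (length-filter-tabulate (T? ∘ p ∘ (f zero ,_)) g))
                 (length-filterᵇ-cartesianProduct p (f ∘ suc) g) ⟩
  # (λ j → p (f zero , g j)) + sum (λ i → # (λ j → p (f (suc i) , g j))) ∎
  where
  open ≡.≡-Reasoning
  row  = List.map (f zero ,_) (List.tabulate g)
  rest = List.cartesianProduct (List.tabulate (f ∘ suc)) (List.tabulate g)

<ᵇ-either : ∀ a b → a ≢ b → bit (a <ᵇ b) + bit (b <ᵇ a) ≡ 1
<ᵇ-either zero    zero    a≢b = contradiction refl a≢b
<ᵇ-either zero    (suc b) a≢b = refl
<ᵇ-either (suc a) zero    a≢b = refl
<ᵇ-either (suc a) (suc b) a≢b = <ᵇ-either a b (a≢b ∘ cong suc)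

-- Off the diagonal, where `F` lives, exactly one of the two orders of a pair is increasing, and
-- transposition exchanges the two halves of the sum.
handshake : ∀ {n} (F : PairSet n) → sum (λ u → # (mem F u)) ≡ ∣ F ∣ + ∣ F ∣
handshake {n} F = begin
  sum (λ u → # (mem F u))
    ≡⟨ sum-cong-≗ (λ u → ≡.trans (sum-cong-≗ (split u)) (∑-distrib-+ (λ v → bit (up u v)) (λ v → bit (up v u)))) ⟩
  sum (λ u → # (up u) + # (λ v → up v u))
    ≡⟨ ∑-distrib-+ (λ u → # (up u)) (λ u → # (λ v → up v u)) ⟩
  sum (λ u → # (up u)) + sum (λ u → # (λ v → up v u))
    ≡⟨ cong (sum (λ u → # (up u)) +_) (∑-comm (λ u v → bit (up v u))) ⟩
  sum (λ u → # (up u)) + sum (λ u → # (up u))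
    ≡⟨ cong₂ _+_ half half ⟨
  ∣ F ∣ + ∣ F ∣ ∎
  where
  open ≡.≡-Reasoning
  up : Rel₂ n
  up u v = (toℕ u <ᵇ toℕ v) ∧ mem F u v

  half : ∣ F ∣ ≡ sum (λ u → # (up u))
  half = length-filterᵇ-cartesianProduct (λ (u , v) → up u v) (λ u → u) (λ v → v)

  split : ∀ u v → bit (mem F u v) ≡ bit (up u v) + bit (up v u)
  split u v rewrite PairSet.sym F v u with mem F u v in uv
  ... | true  = ≡.trans (≡.sym (<ᵇ-either (toℕ u) (toℕ v) λ eq → true≢false
                  (subst (λ w → mem F u w ≡ true) (≡.sym (Fin.toℕ-injective eq)) uv) (irrefl F u)))
                  (cong₂ (λ x y → bit x + bit y) (≡.sym (∧-identityʳ (toℕ u <ᵇ toℕ v))) (≡.sym (∧-identityʳ (toℕ v <ᵇ toℕ u))))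
  ... | false = ≡.sym (cong₂ (λ x y → bit x + bit y) (∧-zeroʳ (toℕ u <ᵇ toℕ v)) (∧-zeroʳ (toℕ v <ᵇ toℕ u)))

closed : ∀ {n} → PairSet n → Rel₂ n
closed E u v = does (u Fin.≟ v) ∨ mem E u v

closed-refl : ∀ {n} (E : PairSet n) u → closed E u u ≡ true
closed-refl E u = cong (_∨ mem E u u) (dec-true (u Fin.≟ u) refl)

does-sym : ∀ {n} (u v : Fin n) → does (u Fin.≟ v) ≡ does (v Fin.≟ u)
does-sym u v = bool-ext (λ p → dec-true (v Fin.≟ u) (≡.sym (does-true (u Fin.≟ v) p)))
                        (λ p → dec-true (u Fin.≟ v) (≡.sym (does-true (v Fin.≟ u) p)))

closed-sym : ∀ {n} (E : PairSet n) u v → closed E u v ≡ closed E v u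
closed-sym E u v = cong₂ _∨_ (does-sym u v) (PairSet.sym E u v)

everything : ∀ {n} → Mask n
everything _ = true

module _ {n} (E : PairSet n) (k : ℕ) where

  UniformlyEditable : Set
  UniformlyEditable = ∃[ F ] ∣ F ∣ ≤ k × IsUniformCluster (E △ F)

  editable⇒solvable : UniformlyEditable → Solvable (closed E) (k + k) everything
  editable⇒solvable (F , ∣F∣≤k , uc) = s , H , record
    { H-refl  = λ {u} _ → dec-true (class u Fin.≟ class u) refl
    ; H-sym   = λ {u} {v} _ _ uv → ≡.trans (does-sym (class v) (class u)) uv
    ; H-trans = λ {u} {v} {w} _ _ _ uv vw → dec-true (class u Fin.≟ class w)
                  (≡.trans (does-true (class u Fin.≟ class v) uv) (does-true (class v Fin.≟ class w) vw))
    ; uniform = λ {u} _ → ≡.trans (#-cong λ v → does-sym (class u) (class v))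
                  (≡.trans (≡.sym (length-filter-tabulate (λ v → class v Fin.≟ class u) (λ v → v))) (uniform (class u)))
    ; cost≤   = ≤-trans (≤-reflexive (≡.trans (sum-cong-≗ λ u → #-cong (edits u)) (handshake F)))
                        (+-mono-≤ ∣F∣≤k ∣F∣≤k)
    }
    where
    open IsUniformCluster uc
    H : Rel₂ n
    H u v = does (class u Fin.≟ class v)

    xor-cancel : ∀ x {y z} → z ≡ x xor y → x xor z ≡ y
    xor-cancel true  {true}  refl = refl
    xor-cancel true  {false} refl = refl
    xor-cancel false refl = refl

    -- On the diagonal both relations are true and `F` is false; elsewhere `closed E` is `E` and the
    -- symmetric difference cancels.
    edits : ∀ u v → closed E u v xor H u v ≡ mem F u v
    edits u v with u Fin.≟ v
    ... | yes refl = ≡.trans (cong not (dec-true (class u Fin.≟ class u) refl)) (≡.sym (irrefl F u))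
    ... | no  u≢v  = xor-cancel (mem E u v) (bool-ext
          (λ uv → Equivalence.from (adjacency u v) (u≢v , does-true (class u Fin.≟ class v) uv))
          (λ uv → dec-true (class u Fin.≟ class v) (proj₂ (Equivalence.to (adjacency u v) uv))))

  solvable⇒editable : Solvable (closed E) (k + k) everything → UniformlyEditable
  solvable⇒editable (s , H , S) = F , ∣F∣≤k , record
    { r = r ; s = s ; class = class
    ; uniform   = λ i → class-size i (onto i)
    ; adjacency = λ u v → mk⇔ (adjacent⇒ u v) (adjacent⇐ u v)
    }
    where
    open Solution S
    open Partition (partition H (λ _ → H-refl refl) (λ _ _ → H-sym refl refl) (λ _ _ _ → H-trans refl refl refl))

    F : PairSet n
    F .mem u v  = closed E u v xor H u v
    F .PairSet.sym u v  = cong₂ _xor_ (closed-sym E u v) (bool-ext (H-sym refl refl) (H-sym refl refl))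
    -- Both relations are reflexive, so their difference is loopless.
    F .irrefl v = cong₂ _xor_ (closed-refl E v) (H-refl {v} refl)

    ∣F∣≤k : ∣ F ∣ ≤ k
    ∣F∣≤k = ≮⇒≥ λ k<∣F∣ → <⇒≱ (+-mono-< k<∣F∣ k<∣F∣) (≤-trans (≤-reflexive (≡.sym (handshake F))) cost≤)

    class-size : ∀ i → ∃[ u ] class u ≡ i → length (List.filter (λ v → class v Fin.≟ i) (allFin n)) ≡ s
    class-size i (u , refl) = ≡.trans (length-filter-tabulate (λ v → class v Fin.≟ class u) (λ v → v))
      (≡.trans (#-cong λ v → bool-ext
                 (λ p → exact⁻¹ (≡.sym (does-true (class v Fin.≟ class u) p)))
                 (λ uv → dec-true (class v Fin.≟ class u) (≡.sym (exact u v uv))))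
               (uniform {u} refl))
      where
      exact⁻¹ : ∀ {v} → class u ≡ class v → H u v ≡ true
      exact⁻¹ = sound u _

    xor-cancelˡ : ∀ x y → x xor (x xor y) ≡ y
    xor-cancelˡ true  true  = refl
    xor-cancelˡ true  false = refl
    xor-cancelˡ false y     = refl

    edited : ∀ {u v} → u ≢ v → mem (E △ F) u v ≡ H u v
    edited {u} {v} u≢v rewrite dec-false (u Fin.≟ v) u≢v = xor-cancelˡ (mem E u v) (H u v)

    adjacent⇒ : ∀ u v → mem (E △ F) u v ≡ true → u ≢ v × class u ≡ class v
    adjacent⇒ u v uv = u≢v , exact u v (≡.trans (≡.sym (edited u≢v)) uv)
      where
      u≢v : u ≢ v
      u≢v refl = true≢false uv (irrefl (E △ F) u)

    adjacent⇐ : ∀ u v → u ≢ v × class u ≡ class v → mem (E △ F) u v ≡ true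
    adjacent⇐ u v (u≢v , eq) = ≡.trans (edited u≢v) (sound u v eq)

-- Induced subgraphs

present : ∀ {n} → Mask n → List (Fin n)
present A = filterᵇ A (allFin _)

length-filterᵇ-present : ∀ {n} (A p : Mask n) → length (filterᵇ p (present A)) ≡ # (λ v → A v ∧ p v)
length-filterᵇ-present A p = ≡.trans (cong length (filterᵇ-filterᵇ A p (allFin _)))
                                     (length-filter-tabulate (λ v → T? (A v ∧ p v)) (λ v → v))

editCost-present : ∀ {n} (A : Mask n) M H →
  ListAction.sum (List.map (λ u → # (λ v → A v ∧ (M u v xor H u v))) (present A)) ≡ editCost A M H
editCost-present {n} A M H =
  ≡.trans (sum-filterᵇ-tabulate A (λ u → # (λ v → A v ∧ (M u v xor H u v))) (λ u → u)) (sum-cong-≗ guard)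
  where
  guard : ∀ u → (Bool.if A u then # (λ v → A v ∧ (M u v xor H u v)) else 0) ≡ # (mismatch A M H u)
  guard u with A u
  ... | true  = refl
  ... | false = ≡.sym (#-false {n} λ _ → refl)

induced : ∀ {n} → PairSet n → (l : List (Fin n)) → PairSet (length l)
induced E l .mem i j = mem E (List.lookup l i) (List.lookup l j)
induced E l .PairSet.sym i j = PairSet.sym E _ _
induced E l .irrefl i = irrefl E _

lookup-injective : ∀ {A : Set} {xs : List A} → Unique xs → ∀ i j → List.lookup xs i ≡ List.lookup xs j → i ≡ j
lookup-injective (_  ∷ _) zero    zero    _  = refl
lookup-injective (x∉ ∷ _) zero    (suc j) eq = contradiction eq (All.lookup x∉ (∈-lookup j))
lookup-injective (x∉ ∷ _) (suc i) zero    eq = contradiction (≡.sym eq) (All.lookup x∉ (∈-lookup i))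
lookup-injective (_  ∷ u) (suc i) (suc j) eq = cong suc (lookup-injective u i j eq)

module _ {n} (E : PairSet n) (K : ℕ) (A : Mask n) where

  private
    l = present A

    e : Fin (length l) → Fin n
    e = List.lookup l

    e-injective : ∀ {i j} → e i ≡ e j → i ≡ j
    e-injective {i} {j} = lookup-injective (filter⁺ (T? ∘ A) (allFin⁺ n)) i j

    A∘e : ∀ i → A (e i) ≡ true
    A∘e i with A (e i) | proj₂ (∈-filter⁻ (T? ∘ A) {xs = allFin n} (∈-lookup {xs = l} i))
    ... | true | _ = refl

    e-onto : ∀ {u} → A u ≡ true → ∃[ i ] e i ≡ u
    e-onto {u} Au = index u∈l , ≡.sym (lookup-index u∈l)
      where
      u∈l : u ∈ l
      u∈l = ∈-filter⁺ (T? ∘ A) (∈-allFin u) (subst T (≡.sym Au) _)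

    sum-e : ∀ g → sum (g ∘ e) ≡ sum (λ u → Bool.if A u then g u else 0)
    sum-e g = ≡.trans (sum-lookup g l) (sum-filterᵇ-tabulate A g (λ u → u))

    #-e : ∀ p → # (p ∘ e) ≡ # (λ u → A u ∧ p u)
    #-e p = ≡.trans (sum-e (bit ∘ p)) (sum-cong-≗ λ u → pointwise (A u) (p u))
      where
      pointwise : ∀ a x → (Bool.if a then bit x else 0) ≡ bit (a ∧ x)
      pointwise true  x = refl
      pointwise false x = refl

    closed-e : ∀ i j → closed (induced E l) i j ≡ closed E (e i) (e j)
    closed-e i j = cong (_∨ mem E (e i) (e j)) (bool-ext
      (λ p → dec-true (e i Fin.≟ e j) (cong e (does-true (i Fin.≟ j) p)))
      (λ p → dec-true (i Fin.≟ j) (e-injective (does-true (e i Fin.≟ e j) p))))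

    module _ {H : Rel₂ n} {H′ : Rel₂ (length l)} (agree : ∀ i j → H (e i) (e j) ≡ H′ i j) where

      deg-e : ∀ i → deg H′ everything i ≡ deg H A (e i)
      deg-e i = ≡.trans (#-cong λ j → ≡.sym (agree i j)) (#-e (H (e i)))

      cost-e : editCost everything (closed (induced E l)) H′ ≡ editCost A (closed E) H
      cost-e = ≡.trans
        (sum-cong-≗ λ i → ≡.trans (#-cong λ j → cong₂ _xor_ (closed-e i j) (≡.sym (agree i j)))
                                  (#-e (λ v → closed E (e i) v xor H (e i) v)))
        (≡.trans (sum-lookup (λ u → # (λ v → A v ∧ (closed E u v xor H u v))) l) (editCost-present A (closed E) H))

  solvable⇒induced : Solvable (closed E) K A → Solvable (closed (induced E l)) K everything
  solvable⇒induced (s , H , S) = s , (λ i j → H (e i) (e j)) , record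
    { H-refl  = λ {i} _ → H-refl (A∘e i)
    ; H-sym   = λ {i} {j} _ _ → H-sym (A∘e i) (A∘e j)
    ; H-trans = λ {i} {j} {k} _ _ _ → H-trans (A∘e i) (A∘e j) (A∘e k)
    ; uniform = λ {i} _ → ≡.trans (deg-e {H} (λ _ _ → refl) i) (uniform (A∘e i))
    ; cost≤   = ≤-trans (≤-reflexive (cost-e {H} (λ _ _ → refl))) cost≤
    }
    where open Solution S

  induced⇒solvable : Solvable (closed (induced E l)) K everything → Solvable (closed E) K A
  induced⇒solvable (s , H , S) = s , Ĥ , record
    { H-refl  = λ Au → refl′ (e-onto Au)
    ; H-sym   = λ Au Av → sym′ (e-onto Au) (e-onto Av)
    ; H-trans = λ Au Av Aw → trans′ (e-onto Au) (e-onto Av) (e-onto Aw)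
    ; uniform = λ Au → uniform′ (e-onto Au)
    ; cost≤   = ≤-trans (≤-reflexive (≡.sym (cost-e {Ĥ} Ĥ-e))) cost≤
    }
    where
    open Solution S

    -- The embedding `e` has an inverse on `A` only, so the relation is transported by searching for
    -- preimages; outside `A` the search fails and the relation is false.
    Ĥ : Rel₂ n
    Ĥ u v = any λ i → any λ j → does (e i Fin.≟ u) ∧ (does (e j Fin.≟ v) ∧ H i j)

    Ĥ-e : ∀ i j → Ĥ (e i) (e j) ≡ H i j
    Ĥ-e i j = bool-ext to from
      where
      to : Ĥ (e i) (e j) ≡ true → H i j ≡ true
      to p with i′ , p′ ← any-elim {p = λ i′ → any λ j′ → does (e i′ Fin.≟ e i) ∧ (does (e j′ Fin.≟ e j) ∧ H i′ j′)} p
           with j′ , q ← any-elim {p = λ j′ → does (e i′ Fin.≟ e i) ∧ (does (e j′ Fin.≟ e j) ∧ H i′ j′)} p′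
           with refl ← e-injective (does-true (e i′ Fin.≟ e i) (∧ˡ (does (e i′ Fin.≟ e i)) q))
           with q′ ← ∧ʳ (does (e i Fin.≟ e i)) q
           with refl ← e-injective (does-true (e j′ Fin.≟ e j) (∧ˡ (does (e j′ Fin.≟ e j)) q′))
           = ∧ʳ (does (e j Fin.≟ e j)) q′
      from : H i j ≡ true → Ĥ (e i) (e j) ≡ true
      from ij = any-intro i (any-intro j (∧-intro (dec-true (e i Fin.≟ e i) refl)
                                                  (∧-intro (dec-true (e j Fin.≟ e j) refl) ij)))

    refl′ : ∀ {u} → ∃[ i ] e i ≡ u → Ĥ u u ≡ true
    refl′ (i , refl) = ≡.trans (Ĥ-e i i) (H-refl refl)

    sym′ : ∀ {u v} → ∃[ i ] e i ≡ u → ∃[ j ] e j ≡ v → Ĥ u v ≡ true → Ĥ v u ≡ true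
    sym′ (i , refl) (j , refl) uv = ≡.trans (Ĥ-e j i) (H-sym refl refl (≡.trans (≡.sym (Ĥ-e i j)) uv))

    trans′ : ∀ {u v w} → ∃[ i ] e i ≡ u → ∃[ j ] e j ≡ v → ∃[ k ] e k ≡ w →
             Ĥ u v ≡ true → Ĥ v w ≡ true → Ĥ u w ≡ true
    trans′ (i , refl) (j , refl) (k , refl) uv vw = ≡.trans (Ĥ-e i k)
      (H-trans refl refl refl (≡.trans (≡.sym (Ĥ-e i j)) uv) (≡.trans (≡.sym (Ĥ-e j k)) vw))

    uniform′ : ∀ {u} → ∃[ i ] e i ≡ u → deg Ĥ A u ≡ s
    uniform′ (i , refl) = ≡.trans (≡.sym (deg-e {Ĥ} Ĥ-e i)) (uniform refl)

-- The kernelization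

module _ {n} (M : Rel₂ n) (K : ℕ) where

  stepFrom : List (Fin n) → Mask n → Mask n
  stepFrom []      A = A
  stepFrom (a ∷ _) A = without M A a

  step : Mask n → Mask n
  step A = stepFrom (filterᵇ (reducible M K A) (present A)) A

  iterate : ℕ → Mask n → Mask n
  iterate zero    A = A
  iterate (suc m) A = iterate m (step A)

  Irreducible : Mask n → Set
  Irreducible A = ∀ u → A u ≡ true → reducible M K A u ≡ false

  data StepView (A : Mask n) : Set where
    stuck   : step A ≡ A → Irreducible A → StepView A
    deletes : ∀ a → A a ≡ true → reducible M K A a ≡ true → step A ≡ without M A a → StepView A

  stepView : ∀ A → StepView A
  stepView A with filterᵇ (reducible M K A) (present A) in eq
  ... | [] = stuck (cong (λ l → stepFrom l A) eq) λ u Au → ≢true⇒false λ red →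
        contradiction (≤-trans (#-positive {p = λ v → A v ∧ reducible M K A v} u (∧-intro Au red))
                        (≤-reflexive (≡.trans (≡.sym (length-filterᵇ-present A (reducible M K A))) (cong length eq)))) λ ()
  ... | a ∷ l = deletes a (∧ˡ (A a) Ared) (∧ʳ (A a) Ared) (cong (λ l → stepFrom l A) eq)
    where
    Ared : A a ∧ reducible M K A a ≡ true
    Ared = filterᵇ-head (allFin n) (≡.trans (≡.sym (filterᵇ-filterᵇ A (reducible M K A) (allFin n))) eq)

  iterate-stuck : ∀ {A} m → step A ≡ A → iterate m A ≡ A
  iterate-stuck zero    eq = refl
  iterate-stuck (suc m) eq = ≡.trans (cong (iterate m) eq) (iterate-stuck m eq)

  module _ (M-refl : ∀ u → M u u ≡ true) (M-sym : ∀ u v → M u v ≡ M v u) where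

    step-⇔ : ∀ A → Solvable M K A ⇔ Solvable M K (step A)
    step-⇔ A with stepView A
    ... | stuck eq _ rewrite eq = ⇔-id _
    ... | deletes a Aa red eq rewrite eq =
          mk⇔ (delete-clique M M-refl M-sym K Aa red) (restore-clique M M-refl M-sym K Aa red)

    iterate-⇔ : ∀ m A → Solvable M K A ⇔ Solvable M K (iterate m A)
    iterate-⇔ zero    A = ⇔-id _
    iterate-⇔ (suc m) A = iterate-⇔ m (step A) ⇔-∘ step-⇔ A

    #-without : ∀ {A a} → A a ≡ true → # (without M A a) < # A
    #-without {A} {a} Aa = #-strict a (λ v → ∧ˡ (A v)) Aa (≢true⇒false λ p →
      true≢false (M-refl a) (not-true (∧ʳ (A a) p)))

    -- Each deletion removes at least `a` itself, because `M` is reflexive, and a mask that is stuck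
    -- stays so in the remaining rounds. As many rounds as there are vertices therefore suffice.
    iterate-irreducible : ∀ m A → # A ≤ m → Irreducible (iterate m A)
    iterate-irreducible zero A #A≤0 u Au = true≢false Au (#-≤0 #A≤0 u)
    iterate-irreducible (suc m) A #A≤m with stepView A
    ... | stuck eq irr = subst Irreducible (≡.sym (iterate-stuck (suc m) eq)) irr
    ... | deletes a Aa _ eq rewrite eq =
          iterate-irreducible m (without M A a) (s≤s⁻¹ (≤-trans (#-without Aa) #A≤m))

  survivors : Mask n
  survivors = iterate n everything

  all : Mask n → Mask n → Bool
  all A p = # (λ u → A u ∧ not (p u)) ≤ᵇ 0

  all-elim : ∀ A p → all A p ≡ true → ∀ {u} → A u ≡ true → p u ≡ true
  all-elim A p ap {u} Au with p u in pu
  ... | true  = refl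
  ... | false = true≢false (∧-intro Au (cong not pu)) (#-≤0 {p = λ u → A u ∧ not (p u)} (≤ᵇ-true ap) u)

  all-intro : ∀ A p → (∀ {u} → A u ≡ true → p u ≡ true) → all A p ≡ true
  all-intro A p f = ≤⇒≤ᵇ-true (≤-reflexive (#-false {p = λ u → A u ∧ not (p u)} λ u → ≢true⇒false λ q →
    true≢false (f (∧ˡ (A u) q)) (not-true (∧ʳ (A u) q))))

  close : Mask n → Rel₂ n
  close A u v = dist M A u v ≤ᵇ K

  uniformRow : Mask n → Fin n → Bool
  uniformRow A u = iso (close A) A u ∧ all A (λ v → deg (close A) A u ≤ᵇ deg (close A) A v)

  uniformCluster : Mask n → Bool
  uniformCluster A = all A (uniformRow A)

  withinBudget : Mask n → Bool
  withinBudget A = 1 ≤ᵇ (suc K ∸ editCost A M (close A))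

  small : Mask n → Bool
  small A = # A ∸ K * K ∸ K ≤ᵇ K

  small⇒#≤ : ∀ {A} → small A ≡ true → # A ≤ K * K + (K + K)
  small⇒#≤ {A} sm = ≤-trans (m≤n+m∸n (# A) (K * K)) (+-monoʳ-≤ (K * K)
    (≤-trans (m≤n+m∸n (# A ∸ K * K) K) (+-monoʳ-≤ K (≤ᵇ-true sm))))

  #≤⇒small : ∀ {A} → # A ≤ K * K + (K + K) → small A ≡ true
  #≤⇒small {A} #A≤ = ≤⇒≤ᵇ-true (m≤n+o⇒m∸n≤o (# A ∸ K * K) K (m≤n+o⇒m∸n≤o (# A) (K * K) #A≤))

  close-solves : ∀ {A} → uniformCluster A ≡ true → withinBudget A ≡ true → Solvable M K A
  close-solves {A} uni bud = commonDegree , close A , record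
    { H-refl  = λ {u} _ → ≤⇒≤ᵇ-true (≤-trans (≤-reflexive (dist-refl M A u)) z≤n)
    ; H-sym   = λ {u} {v} _ _ uv → ≡.trans (cong (_≤ᵇ K) (dist-sym M A v u)) uv
    ; H-trans = λ Au Av Aw uv vw → ≡.trans (iso-elim (close A) A (row Au) Av uv Aw) vw
    ; uniform = λ {u} Au → uniform Au
    ; cost≤   = s≤s⁻¹ (m<n⇒0<n∸m⁻¹ (≤ᵇ-true bud))
    }
    where
    m<n⇒0<n∸m⁻¹ : 1 ≤ suc K ∸ editCost A M (close A) → editCost A M (close A) < suc K
    m<n⇒0<n∸m⁻¹ pos = ≰⇒> λ le → contradiction (≤-trans pos (≤-reflexive (m≤n⇒m∸n≡0 le))) λ ()

    row : ∀ {u} → A u ≡ true → iso (close A) A u ≡ true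
    row {u} Au = ∧ˡ (iso (close A) A u) (all-elim A (uniformRow A) uni Au)

    deg≤deg : ∀ {u v} → A u ≡ true → A v ≡ true → deg (close A) A u ≤ deg (close A) A v
    deg≤deg {u} Au Av = ≤ᵇ-true (all-elim A (λ v → deg (close A) A u ≤ᵇ deg (close A) A v)
      (∧ʳ (iso (close A) A u) (all-elim A (uniformRow A) uni Au)) Av)

    representative : (∃[ a ] A a ≡ true) ⊎ (∀ u → A u ≡ false)
    representative with any A in anyA
    ... | true  = inj₁ (any-elim anyA)
    ... | false = inj₂ (any-false anyA)

    commonDegree : ℕ
    commonDegree with representative
    ... | inj₁ (a , _) = deg (close A) A a
    -- With no vertex present every size is vacuously right.
    ... | inj₂ _       = 0

    uniform : ∀ {u} → A u ≡ true → deg (close A) A u ≡ commonDegree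
    uniform {u} Au with representative
    ... | inj₁ (a , Aa) = ≤-antisym (deg≤deg Au Aa) (deg≤deg Aa Au)
    ... | inj₂ none     = true≢false Au (none u)

  module _ {A s H} (S : Solution M K A s H) (K<s : K < s) where
    open Solution S

    private
      agree : ∀ {u} → A u ≡ true → ∀ {v} → A v ≡ true → close A u v ≡ H u v
      agree Au Av = ≡.sym (large⇒close M K S K<s Au Av)

      deg-close : ∀ {u} → A u ≡ true → deg (close A) A u ≡ s
      deg-close Au = ≡.trans (#-cong λ v → ∧-congʳ-when (agree Au {v})) (uniform Au)

    large⇒uniformCluster : uniformCluster A ≡ true
    large⇒uniformCluster = all-intro A (uniformRow A) λ {u} Au → ∧-intro
      (iso-intro (close A) A λ Aw Av uw → ≡.trans (agree Au Av)
        (≡.trans (H-row Au Aw (≡.trans (≡.sym (agree Au Aw)) uw) Av) (≡.sym (agree Aw Av))))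
      (all-intro A (λ v → deg (close A) A u ≤ᵇ deg (close A) A v) λ Av → ≤⇒≤ᵇ-true (≤-reflexive (≡.trans (deg-close Au) (≡.sym (deg-close Av)))))

    large⇒withinBudget : withinBudget A ≡ true
    large⇒withinBudget = ≤⇒≤ᵇ-true (m<n⇒0<n∸m (s≤s (≤-trans (≤-reflexive same-cost) cost≤)))
      where
      same-cost : editCost A M (close A) ≡ editCost A M H
      same-cost = sum-cong-≗ λ u → #-cong λ v → ∧-congʳ-when λ Au → ∧-congʳ-when λ Av →
        cong (M u v xor_) (agree Au Av)

  -- Used through its contrapositive: when the smallness test fails and one of the other two fails
  -- as well, there is no solution, whatever s is.
  irreducible⇒small⊎large : ∀ {A} → Irreducible A → Solvable M K A →
    small A ≡ true ⊎ (uniformCluster A ≡ true × withinBudget A ≡ true)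
  irreducible⇒small⊎large irr (s , H , S) with s ≤? K
  ... | yes s≤K = inj₁ (#≤⇒small (irreducible⇒small M K S s≤K irr))
  ... | no  s≰K = inj₂ (large⇒uniformCluster S (≰⇒> s≰K) , large⇒withinBudget S (≰⇒> s≰K))

-- Constant yes- and no-instances

noEdges : PairSet 0
noEdges = record { mem = λ () ; sym = λ () ; irrefl = λ () }

yesInstance : Instance
yesInstance = graph 0 noEdges ,, 1

yes-solvable : UCEE yesInstance
yes-solvable = noEdges , z≤n , record
  { r = 0 ; s = 0 ; class = λ () ; uniform = λ () ; adjacency = λ () }

-- A triangle and three isolated vertices: one edit touches two vertices
-- only, so that a vertex of degree 2 and one of degree 0 keep their degrees.
triangle : PairSet 6
triangle .mem u v    = (toℕ u <ᵇ 3) ∧ ((toℕ v <ᵇ 3) ∧ not (does (u Fin.≟ v)))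
triangle .PairSet.sym u v with toℕ u <ᵇ 3 | toℕ v <ᵇ 3
... | true  | true  = cong not (does-sym u v)
... | true  | false = refl
... | false | true  = refl
... | false | false = refl
triangle .irrefl v with toℕ v <ᵇ 3
... | true  = cong not (dec-true (v Fin.≟ v) refl)
... | false = refl

noInstance : Instance
noInstance = graph 6 triangle ,, 1

no-unsolvable : ¬ UCEE noInstance
no-unsolvable yes′
  with s , H , S ← editable⇒solvable triangle 1 yes′
  -- There are three vertices on each side and at most two touched ones. Degrees are closed, hence
  -- the values 3 and 1 below.
  with u , _ , u<3 , tu ← untouched-exists (closed triangle) 2 S (λ u → toℕ u <ᵇ 3) ≤-refl
  with v , _ , v≥3 , tv ← untouched-exists (closed triangle) 2 S (λ v → not (toℕ v <ᵇ 3)) ≤-refl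
  = contradiction (≡.trans (≡.sym (deg-inside u u<3)) (≡.trans (untouched-deg (closed triangle) 2 S {u} refl tu)
      (≡.trans (≡.sym (untouched-deg (closed triangle) 2 S {v} refl tv)) (deg-outside v v≥3)))) λ ()
  where
  deg-inside : ∀ u → (toℕ u <ᵇ 3) ≡ true → deg (closed triangle) everything u ≡ 3
  deg-inside zero             _ = refl
  deg-inside (suc zero)       _ = refl
  deg-inside (suc (suc zero)) _ = refl

  deg-outside : ∀ u → not (toℕ u <ᵇ 3) ≡ true → deg (closed triangle) everything u ≡ 1
  deg-outside (suc (suc (suc zero)))             _ = refl
  deg-outside (suc (suc (suc (suc zero))))       _ = refl
  deg-outside (suc (suc (suc (suc (suc zero))))) _ = refl

-- The reduction and its correctness

module _ (I : Instance) where

  private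
    E = edges (input I)
    k = param I
    M = closed E
    K = k + k

  kept : Mask (order (input I))
  kept = survivors M K

  keptInstance : Instance
  keptInstance = _,,_ (graph (length (present kept)) (induced E (present kept))) k {{param-positive I}}

  reduce : Instance
  reduce = Bool.if small M K kept then keptInstance else
           (Bool.if uniformCluster M K kept ∧ withinBudget M K kept then yesInstance else noInstance)

  private
    editable⇔kept : UCEE I ⇔ Solvable M K kept
    editable⇔kept = iterate-⇔ M K (closed-refl E) (closed-sym E) (order (input I)) everything
                    ⇔-∘ mk⇔ (editable⇒solvable E k) (solvable⇒editable E k)

    kept⇔keptInstance : Solvable M K kept ⇔ UCEE keptInstance
    kept⇔keptInstance =
      mk⇔ (solvable⇒editable (induced E (present kept)) k ∘ solvable⇒induced E K kept)
          (induced⇒solvable E K kept ∘ editable⇒solvable (induced E (present kept)) k)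

    kept-irreducible : Irreducible M K kept
    kept-irreducible = iterate-irreducible M K (closed-refl E) (closed-sym E) (order (input I)) everything
                         (≤-reflexive #-all)

  reduce-correct : UCEE I ⇔ UCEE reduce
  reduce-correct with small M K kept in sm
  ... | true = kept⇔keptInstance ⇔-∘ editable⇔kept
  ... | false with uniformCluster M K kept in uni | withinBudget M K kept in bud
  ...   | true  | true  = mk⇔ (λ _ → yes-solvable) (λ _ → Equivalence.from editable⇔kept (close-solves M K uni bud))
  ...   | true  | false = mk⇔ (λ q → contradiction (Equivalence.to editable⇔kept q) (impossible λ _ → bud)) (λ r → contradiction r no-unsolvable)
    where
    impossible : (uniformCluster M K kept ≡ true → withinBudget M K kept ≡ false) → ¬ Solvable M K kept
    impossible bad sol with irreducible⇒small⊎large M K kept-irreducible sol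
    ... | inj₁ sm′        = true≢false sm′ sm
    ... | inj₂ (u , b)    = true≢false b (bad u)
  ...   | false | _     = mk⇔ (λ q → contradiction (Equivalence.to editable⇔kept q) impossible) (λ r → contradiction r no-unsolvable)
    where
    impossible : ¬ Solvable M K kept
    impossible sol with irreducible⇒small⊎large M K kept-irreducible sol
    ... | inj₁ sm′        = true≢false sm′ sm
    ... | inj₂ (u , b)    = true≢false u uni

  reduce-order : order (input reduce) ≤ (k + k) * (k + k) + ((k + k) + (k + k)) + 6
  reduce-order with small M K kept in sm
  ... | true = m≤n⇒m≤n+o 6 (≤-trans (≤-reflexive (length-filter-tabulate (T? ∘ kept) id)) (small⇒#≤ M K sm))
  ... | false with uniformCluster M K kept ∧ withinBudget M K kept
  ...   | true  = z≤n
  ...   | false = m≤n+m 6 (K * K + (K + K))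

  reduce-param : param reduce ≤ k
  reduce-param with small M K kept
  ... | true = ≤-refl
  ... | false with uniformCluster M K kept ∧ withinBudget M K kept
  -- The constant instances have parameter 1, which is at most `k` because parameters are positive.
  ...   | true  = >-nonZero⁻¹ k {{param-positive I}}
  ...   | false = >-nonZero⁻¹ k {{param-positive I}}

-- The program on encodings

andT-encode : ∀ {x y a b} → x ≡ encodeBool a → y ≡ encodeBool b → andT x y ≡ encodeBool (a ∧ b)
andT-encode {a = true}  refl eq = eq
andT-encode {a = false} refl eq = refl

notT-encode : ∀ {x a} → x ≡ encodeBool a → notT x ≡ encodeBool (not a)
notT-encode {a = true}  refl = refl
notT-encode {a = false} refl = refl

xorT-encode : ∀ {x y a b} → x ≡ encodeBool a → y ≡ encodeBool b → xorT x y ≡ encodeBool (a xor b)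
xorT-encode {a = true}  refl eq = notT-encode eq
xorT-encode {a = false} refl eq = eq

orT-encode : ∀ {x y a b} → x ≡ encodeBool a → y ≡ encodeBool b → caseT x trueT y ≡ encodeBool (a ∨ b)
orT-encode {a = true}  refl eq = refl
orT-encode {a = false} refl eq = eq

spine-encodeℕ : ∀ n → spine (encodeℕ n) ≡ n
spine-encodeℕ zero    = refl
spine-encodeℕ (suc n) = cong suc (spine-encodeℕ n)

spine-encodeList : ∀ xs → spine (encodeList xs) ≡ length xs
spine-encodeList []       = refl
spine-encodeList (x ∷ xs) = cong suc (spine-encodeList xs)

spine-dropT : ∀ i x → spine (dropT i x) ≡ spine x ∸ spine i
spine-dropT leaf       x          = refl
spine-dropT (node _ i) leaf       = ≡.trans (spine-dropT i leaf) (0∸n≡0 (spine i))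
spine-dropT (node _ i) (node _ x) = spine-dropT i x

leqT-encode : ∀ x y {a b} → spine x ≡ a → spine y ≡ b → leqT x y ≡ encodeBool (a ≤ᵇ b)
leqT-encode x y refl refl = ≡.trans (isLeaf (dropT y x)) (cong encodeBool (bool-ext
  (λ p → ≤⇒≤ᵇ-true {spine x} (m∸n≡0⇒m≤n (n≤0⇒n≡0 (≤-trans (≤-reflexive (≡.sym (spine-dropT y x)))
                                                             (≤ᵇ-true {spine (dropT y x)} p)))))
  (λ p → ≤⇒≤ᵇ-true {spine (dropT y x)} (≤-reflexive (≡.trans (spine-dropT y x) (m≤n⇒m∸n≡0 (≤ᵇ-true {spine x} p)))))))
  where
  isLeaf : ∀ z → notT z ≡ encodeBool (spine z ≤ᵇ 0)
  isLeaf leaf       = refl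
  isLeaf (node _ _) = refl

spine-minusSquareT : ∀ x k → spine (minusSquareT x k) ≡ spine x ∸ spine k * spine k
spine-minusSquareT x k = go k x
  where
  go : ∀ j x → spine (foldTails (λ _ acc → dropT k acc) x j) ≡ spine x ∸ spine j * spine k
  go leaf       x = refl
  go (node _ j) x = begin
    spine (foldTails (λ _ acc → dropT k acc) (dropT k x) j) ≡⟨ go j (dropT k x) ⟩
    spine (dropT k x) ∸ spine j * spine k                   ≡⟨ cong (_∸ spine j * spine k) (spine-dropT k x) ⟩
    spine x ∸ spine k ∸ spine j * spine k                   ≡⟨ ∸-+-assoc (spine x) (spine k) (spine j * spine k) ⟩
    spine x ∸ (spine k + spine j * spine k)                 ∎
    where open ≡.≡-Reasoning

reverseT-encode : ∀ xs → reverseT (encodeList xs) ≡ encodeList (List.reverse xs)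
reverseT-encode xs = go [] xs
  where
  go : ∀ ys xs → foldTails (λ t acc → node (head t) acc) (encodeList ys) (encodeList xs) ≡ encodeList (xs ʳ++ ys)
  go ys []       = refl
  go ys (x ∷ xs) = go (x ∷ ys) xs

module _ {A : Set} {e w : A → Tree} {c v : Tree → Tree} {p : A → Bool}
         (c-encode : ∀ x → c (e x) ≡ encodeBool (p x)) (v-encode : ∀ x → v (e x) ≡ w x) where

  filterMapT-encode : ∀ xs → filterMapT c v (encodeList (List.map e xs)) ≡ encodeList (List.map w (filterᵇ p xs))
  filterMapT-encode xs = ≡.trans (cong reverseT (go [] xs))
    (≡.trans (reverseT-encode (List.reverse (List.map w (filterᵇ p xs))))
             (cong encodeList (reverse-involutive (List.map w (filterᵇ p xs)))))
    where
    go : ∀ ys xs → foldTails (λ t acc → caseT (c (head t)) (node (v (head t)) acc) acc) (encodeList ys) (encodeList (List.map e xs))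
                 ≡ encodeList (List.map w (filterᵇ p xs) ʳ++ ys)
    go ys []       = refl
    go ys (x ∷ xs) rewrite c-encode x with p x
    ... | true  rewrite v-encode x = go (w x ∷ ys) xs
    ... | false = go ys xs

filterᵇ-true : ∀ {A : Set} (xs : List A) → filterᵇ (λ _ → true) xs ≡ xs
filterᵇ-true xs = filter-all (T? ∘ λ _ → true) (All.universal (λ _ → _) xs)

mapT-encode : ∀ {A : Set} {e w : A → Tree} {v : Tree → Tree} → (∀ x → v (e x) ≡ w x) →
              ∀ xs → mapT v (encodeList (List.map e xs)) ≡ encodeList (List.map w xs)
mapT-encode {e = e} {w} {v} v-encode xs =
  ≡.trans (filterMapT-encode {e = e} {c = λ _ → trueT} {v = v} (λ _ → refl) v-encode xs) (cong (encodeList ∘ List.map w) (filterᵇ-true xs))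

encodeVertex : ∀ {n} → Fin n → Tree
encodeVertex v = encodeℕ (toℕ v)

encodeVertices : ∀ {n} → List (Fin n) → Tree
encodeVertices l = encodeList (List.map encodeVertex l)

indicesT-encode : ∀ {n} (f : Fin n → Tree) → indicesT (encodeList (List.map f (allFin n))) ≡ encodeVertices (allFin n)
indicesT-encode {n} f = ≡.trans (go [] rows) (cong encodeList (≡.trans (++-identityʳ _)
    (≡.trans (cong (List.applyUpTo encodeℕ) (≡.trans (length-map f (allFin n)) (length-tabulate id)))
             (≡.trans (tabulate-toℕ encodeℕ n) (≡.sym (map-tabulate id encodeVertex))))))
  where
  rows = List.map f (allFin n)

  tabulate-toℕ : ∀ (g : ℕ → Tree) n → List.applyUpTo g n ≡ List.tabulate {n = n} (g ∘ toℕ)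
  tabulate-toℕ g zero    = refl
  tabulate-toℕ g (suc n) = cong (g 0 ∷_) (tabulate-toℕ (g ∘ suc) n)

  count : ∀ xs → mapT (λ _ → leaf) (encodeList xs) ≡ encodeℕ (length xs)
  count xs = ≡.trans (cong (mapT (λ _ → leaf) ∘ encodeList) (≡.sym (map-id xs)))
                     (≡.trans (mapT-encode {e = λ x → x} (λ _ → refl) xs) (leaves xs))
    where
    leaves : ∀ xs → encodeList (List.map (λ _ → leaf) xs) ≡ encodeℕ (length xs)
    leaves []       = refl
    leaves (x ∷ xs) = cong (node leaf) (leaves xs)

  go : ∀ ys xs → foldTails (λ t acc → node (mapT (λ _ → leaf) (tail t)) acc) (encodeList ys) (encodeList xs)
               ≡ encodeList (List.applyUpTo encodeℕ (length xs) List.++ ys)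
  go ys []       = refl
  go ys (x ∷ xs) rewrite count xs = ≡.trans (go (encodeℕ (length xs) ∷ ys) xs) (cong encodeList
    (≡.trans (≡.sym (++-assoc (List.applyUpTo encodeℕ (length xs)) List.[ _ ] ys))
             (cong (List._++ ys) (applyUpTo-∷ʳ encodeℕ (length xs)))))

head-dropT : ∀ {n} (f : Fin n → Tree) i → head (dropT (encodeVertex i) (encodeList (List.map f (allFin n)))) ≡ f i
head-dropT f i = ≡.trans (cong (λ xs → head (dropT (encodeVertex i) (encodeList xs))) (map-tabulate id f)) (go f i)
  where
  go : ∀ {n} (f : Fin n → Tree) i → head (dropT (encodeVertex i) (encodeList (List.tabulate f))) ≡ f i
  go f zero    = refl
  go f (suc i) = go (f ∘ suc) i

lookupT-encode : ∀ {n} (E : PairSet n) u v →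
  lookupT (encodeGraph (graph n E)) (encodeVertex u) (encodeVertex v) ≡ encodeBool (mem E u v)
lookupT-encode E u v = ≡.trans
  (cong (λ row → head (dropT (encodeVertex v) row)) (head-dropT (λ u → encodeList (List.map (λ v → encodeBool (mem E u v)) (allFin _))) u))
  (head-dropT (λ v → encodeBool (mem E u v)) v)

Encodes : ∀ {n} → (Tree → Tree → Tree) → Rel₂ n → Set
Encodes r R = ∀ u v → r (encodeVertex u) (encodeVertex v) ≡ encodeBool (R u v)

closedT-encode : ∀ {n} (E : PairSet n) → Encodes (closedT (encodeGraph (graph n E))) (closed E)
closedT-encode E u v = orT-encode
  (≡.trans (andT-encode (leqT-encode (encodeVertex u) (encodeVertex v) (spine-encodeℕ _) (spine-encodeℕ _))
                        (leqT-encode (encodeVertex v) (encodeVertex u) (spine-encodeℕ _) (spine-encodeℕ _)))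
           (cong encodeBool (bool-ext
             (λ p → dec-true (u Fin.≟ v) (Fin.toℕ-injective
                      (≤-antisym (≤ᵇ-true (∧ˡ (toℕ u ≤ᵇ toℕ v) p)) (≤ᵇ-true (∧ʳ (toℕ u ≤ᵇ toℕ v) p)))))
             (λ p → let eq = cong toℕ (does-true (u Fin.≟ v) p)
                    in ∧-intro (≤⇒≤ᵇ-true (≤-reflexive eq)) (≤⇒≤ᵇ-true (≤-reflexive (≡.sym eq)))))))
  (lookupT-encode E u v)

module _ {n} (A : Mask n) where

  private
    l = encodeVertices (present A)

  filterT-encode : ∀ {c : Tree → Tree} {p : Mask n} → (∀ v → c (encodeVertex v) ≡ encodeBool (p v)) →
                   filterT c l ≡ encodeVertices (filterᵇ p (present A))
  filterT-encode {c} c-encode = filterMapT-encode {e = encodeVertex} {c = c} {v = λ x → x} c-encode (λ _ → refl) (present A)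

  spine-filterT : ∀ {c : Tree → Tree} {p : Mask n} → (∀ v → c (encodeVertex v) ≡ encodeBool (p v)) →
                  spine (filterT c l) ≡ # (λ v → A v ∧ p v)
  spine-filterT {c} {p} c-encode = begin
    spine (filterT c l)                                      ≡⟨ cong spine (filterT-encode {c} c-encode) ⟩
    spine (encodeVertices (filterᵇ p (present A)))           ≡⟨ spine-encodeList (List.map encodeVertex (filterᵇ p (present A))) ⟩
    length (List.map encodeVertex (filterᵇ p (present A)))   ≡⟨ length-map encodeVertex (filterᵇ p (present A)) ⟩
    length (filterᵇ p (present A))                           ≡⟨ length-filterᵇ-present A p ⟩
    # (λ v → A v ∧ p v)                                      ∎
    where open ≡.≡-Reasoning

  allT-encode : ∀ {c : Tree → Tree} {p : Mask n} → (∀ v → c (encodeVertex v) ≡ encodeBool (p v)) →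
                allT c l ≡ encodeBool (# (λ v → A v ∧ not (p v)) ≤ᵇ 0)
  allT-encode {c} c-encode = leqT-encode (filterT (λ v → notT (c v)) l) leaf
    (spine-filterT {c = λ v → notT (c v)} λ v → notT-encode (c-encode v)) refl

  module _ (r : Tree → Tree → Tree) {R : Rel₂ n} (r-encode : Encodes r R) where

    spine-distT : ∀ u v → spine (distT r l (encodeVertex u) (encodeVertex v)) ≡ dist R A u v
    spine-distT u v = spine-filterT
      {c = λ w → xorT (r (encodeVertex u) w) (r (encodeVertex v) w)}
      λ w → xorT-encode (r-encode u w) (r-encode v w)

    spine-degT : ∀ u → spine (degT r l (encodeVertex u)) ≡ deg R A u
    spine-degT u = spine-filterT {c = r (encodeVertex u)} (r-encode u)

    isoT-encode : ∀ u → isoT r l (encodeVertex u) ≡ encodeBool (iso R A u)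
    isoT-encode u = leqT-encode (filterT far l) leaf
      (spine-filterT {c = far} λ w → andT-encode (r-encode u w)
        (notT-encode (leqT-encode (distT r l (encodeVertex u) (encodeVertex w)) leaf (spine-distT u w) refl))) refl
      where
      far : Tree → Tree
      far w = andT (r (encodeVertex u) w) (notT (leqT (distT r l (encodeVertex u) w) leaf))

module _ {n} (E : PairSet n) (K : ℕ) where

  private
    m κ : Tree
    m = encodeGraph (graph n E)
    κ = encodeℕ K
    M = closed E

    spine-κ : spine κ ≡ K
    spine-κ = spine-encodeℕ K

  module _ (A : Mask n) where

    private
      l = encodeVertices (present A)

    reducibleT-encode : ∀ u → reducibleT m κ l (encodeVertex u) ≡ encodeBool (reducible M K A u)
    reducibleT-encode u =
      andT-encode (isoT-encode A (closedT m) (closedT-encode E) u)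
     (andT-encode (leqT-encode (degT (closedT m) l (encodeVertex u)) κ (spine-deg u) spine-κ)
                  (notT-encode (leqT-encode (dropT κ peers) κ
                    (≡.trans (spine-dropT κ peers) (cong₂ _∸_ (spine-filterT A {c = isPeer} peer-encode) spine-κ)) spine-κ)))
      where
      spine-deg = spine-degT A (closedT m) (closedT-encode E)

      isPeer : Tree → Tree
      isPeer w = andT (isoT (closedT m) l w)
                (andT (leqT (degT (closedT m) l w) (degT (closedT m) l (encodeVertex u)))
                      (leqT (degT (closedT m) l (encodeVertex u)) (degT (closedT m) l w)))

      peers = filterT isPeer l

      peer-encode : ∀ w → isPeer (encodeVertex w) ≡ encodeBool (peer M A (deg M A u) w)
      peer-encode w = andT-encode (isoT-encode A (closedT m) (closedT-encode E) w)
        (andT-encode (leqT-encode (degT (closedT m) l (encodeVertex w)) (degT (closedT m) l (encodeVertex u)) (spine-deg w) (spine-deg u))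
                     (leqT-encode (degT (closedT m) l (encodeVertex u)) (degT (closedT m) l (encodeVertex w)) (spine-deg u) (spine-deg w)))

    stepFromT-encode : ∀ c → stepFromT m (encodeVertices c) l ≡ encodeVertices (present (stepFrom M K c A))
    stepFromT-encode []      = refl
    stepFromT-encode (a ∷ _) = ≡.trans
      (filterT-encode A {c = λ v → notT (closedT m (encodeVertex a) v)} (λ v → notT-encode (closedT-encode E a v)))
      (cong encodeVertices (filterᵇ-filterᵇ A (λ v → not (M a v)) (allFin n)))

    stepT-encode : stepT m κ l ≡ encodeVertices (present (step M K A))
    stepT-encode = ≡.trans (cong (λ c → stepFromT m c l) (filterT-encode A {c = reducibleT m κ l} reducibleT-encode))
                           (stepFromT-encode (filterᵇ (reducible M K A) (present A)))

    smallT-encode : smallT κ l ≡ encodeBool (small M K A)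
    smallT-encode = leqT-encode (dropT κ (minusSquareT l κ)) κ (begin
      spine (dropT κ (minusSquareT l κ))        ≡⟨ spine-dropT κ (minusSquareT l κ) ⟩
      spine (minusSquareT l κ) ∸ spine κ        ≡⟨ cong (_∸ spine κ) (spine-minusSquareT l κ) ⟩
      spine l ∸ spine κ * spine κ ∸ spine κ     ≡⟨ cong₂ (λ x y → x ∸ y * y ∸ y) spine-l spine-κ ⟩
      # A ∸ K * K ∸ K                           ∎) spine-κ
      where
      open ≡.≡-Reasoning
      spine-l : spine l ≡ # A
      spine-l = ≡.trans (spine-encodeList (List.map encodeVertex (present A))) (≡.trans (length-map encodeVertex (present A))
                        (length-filter-tabulate (T? ∘ A) id))

    closeT-encode : Encodes (closeT (node m (node κ l))) (close M K A)
    closeT-encode u v = leqT-encode (distT (closedT m) l (encodeVertex u) (encodeVertex v)) κ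
                          (spine-distT A (closedT m) (closedT-encode E) u v) spine-κ

    uniformT-encode : uniformT (node m (node κ l)) l ≡ encodeBool (uniformCluster M K A)
    uniformT-encode = allT-encode A {c = λ u → andT (isoT r l u) (allT (λ v → leqT (degT r l u) (degT r l v)) l)} λ u →
      andT-encode (isoT-encode A r closeT-encode u)
        (allT-encode A {c = λ v → leqT (degT r l (encodeVertex u)) (degT r l v)} λ v →
          leqT-encode (degT r l (encodeVertex u)) (degT r l (encodeVertex v))
                      (spine-degT A r closeT-encode u) (spine-degT A r closeT-encode v))
      where
      r = closeT (node m (node κ l))

    withinBudgetT-encode : withinBudgetT m κ l ≡ encodeBool (withinBudget M K A)
    withinBudgetT-encode = leqT-encode trueT (foldTails pay (node leaf κ) l) refl
      (≡.trans (go (present A) (node leaf κ)) (cong₂ _∸_ (cong suc spine-κ) (editCost-present A M (close M K A))))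
      where
      differ : Tree → Tree → Tree
      differ t v = xorT (closedT m (head t) v) (closeT (node m (node κ l)) (head t) v)

      pay : Tree → Tree → Tree
      pay t acc = dropT (filterT (differ t) l) acc

      price : Fin n → ℕ
      price u = # (λ v → A v ∧ (M u v xor close M K A u v))

      go : ∀ us acc → spine (foldTails pay acc (encodeVertices us)) ≡ spine acc ∸ ListAction.sum (List.map price us)
      go []       acc = refl
      go (u ∷ us) acc = begin
        spine (foldTails pay (dropT spent acc) (encodeVertices us))
          ≡⟨ go us (dropT spent acc) ⟩
        spine (dropT spent acc) ∸ ListAction.sum (List.map price us)
          ≡⟨ cong (_∸ ListAction.sum (List.map price us)) (≡.trans (spine-dropT spent acc)
               (cong (spine acc ∸_) (spine-filterT A {c = differ (node (encodeVertex u) (encodeVertices us))}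
                                           (λ v → xorT-encode (closedT-encode E u v) (closeT-encode u v))))) ⟩
        spine acc ∸ price u ∸ ListAction.sum (List.map price us)
          ≡⟨ ∸-+-assoc (spine acc) (price u) (ListAction.sum (List.map price us)) ⟩
        spine acc ∸ (price u + ListAction.sum (List.map price us)) ∎
        where
        open ≡.≡-Reasoning
        spent = filterT (differ (node (encodeVertex u) (encodeVertices us))) l

  survivorsT-encode : survivorsT m κ ≡ encodeVertices (present (survivors M K))
  survivorsT-encode = begin
    foldTails (λ _ l → stepT m κ l) (indicesT m) m
      ≡⟨ cong (λ l → foldTails (λ _ l → stepT m κ l) l m)
              (≡.trans (indicesT-encode rowT) (cong encodeVertices (≡.sym (filterᵇ-true (allFin n))))) ⟩
    foldTails (λ _ l → stepT m κ l) (encodeVertices (present (everything {n}))) m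
      ≡⟨ go (List.map rowT (allFin n)) (everything {n}) ⟩
    encodeVertices (present (iterate M K (length (List.map rowT (allFin n))) (everything {n})))
      ≡⟨ cong (λ j → encodeVertices (present (iterate M K j (everything {n}))))
              (≡.trans (length-map rowT (allFin n)) (length-tabulate {n = n} id)) ⟩
    encodeVertices (present (survivors M K)) ∎
    where
    open ≡.≡-Reasoning
    rowT : Fin n → Tree
    rowT u = encodeList (List.map (λ v → encodeBool (mem E u v)) (allFin n))

    go : ∀ xs A → foldTails (λ _ l → stepT m κ l) (encodeVertices (present A)) (encodeList xs)
                ≡ encodeVertices (present (iterate M K (length xs) A))
    go []       A = refl
    go (x ∷ xs) A = ≡.trans (cong (λ l → foldTails (λ _ l → stepT m κ l) l (encodeList xs)) (stepT-encode A)) (go xs (step M K A))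

  submatrixT-encode : ∀ l → submatrixT m (encodeVertices l) ≡ encodeGraph (graph (length l) (induced E l))
  submatrixT-encode l = ≡.trans
    (mapT-encode {e = encodeVertex} {v = λ x → mapT (lookupT m x) (encodeVertices l)}
      (λ u → mapT-encode {e = encodeVertex} {v = lookupT m (encodeVertex u)} (lookupT-encode E u) l) l)
    (cong encodeList (≡.trans
      (≡.sym (map-lookup (λ u → encodeList (List.map (λ v → encodeBool (mem E u v)) l))))
      (map-cong (λ i → cong encodeList (≡.sym (map-lookup (λ v → encodeBool (mem E (List.lookup l i) v))))) (allFin (length l)))))
    where
    map-lookup : ∀ (f : Fin n → Tree) → List.map (f ∘ List.lookup l) (allFin (length l)) ≡ List.map f l
    map-lookup f = ≡.trans (map-∘ (allFin (length l))) (cong (List.map f) (≡.trans (map-tabulate id (List.lookup l)) (tabulate-lookup l)))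

doubleT-encode : ∀ k → doubleT (encodeℕ k) ≡ encodeℕ (k + k)
doubleT-encode k = go k k
  where
  go : ∀ j i → foldTails (λ _ → node leaf) (encodeℕ i) (encodeℕ j) ≡ encodeℕ (j + i)
  go zero    i = refl
  go (suc j) i = ≡.trans (go j (suc i)) (cong encodeℕ (+-suc j i))

caseT-encode : ∀ b {c x y x′ y′} → c ≡ encodeBool b → x ≡ x′ → y ≡ y′ → caseT c x y ≡ (Bool.if b then x′ else y′)
caseT-encode true  refl eq _ = eq
caseT-encode false refl _ eq = eq

kernelT-encode : ∀ I →
  kernelT (encodeInstance yesInstance) (encodeInstance noInstance) (encodeInstance I) ≡ encodeInstance (reduce I)
kernelT-encode I = begin
  answer (doubleT kT) (survivorsT m (doubleT kT))
    ≡⟨ cong (λ κ → answer κ (survivorsT m κ)) (doubleT-encode k) ⟩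
  answer κ (survivorsT m κ)
    ≡⟨ cong (answer κ) (survivorsT-encode E K) ⟩
  answer κ (encodeVertices (present (kept I)))
    ≡⟨ caseT-encode (small M K (kept I)) (smallT-encode E K (kept I))
         (cong (λ g → node g kT) (submatrixT-encode E K (present (kept I))))
         (caseT-encode (uniformCluster M K (kept I) ∧ withinBudget M K (kept I))
           (andT-encode (uniformT-encode E K (kept I)) (withinBudgetT-encode E K (kept I))) refl refl) ⟩
  (Bool.if small M K (kept I) then encodeInstance (keptInstance I) else
    (Bool.if uniformCluster M K (kept I) ∧ withinBudget M K (kept I)
     then encodeInstance yesInstance else encodeInstance noInstance))
    ≡⟨ cong (Bool.if small M K (kept I) then encodeInstance (keptInstance I) else_)
            (if-float encodeInstance (uniformCluster M K (kept I) ∧ withinBudget M K (kept I))) ⟨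
  (Bool.if small M K (kept I) then encodeInstance (keptInstance I) else
    encodeInstance (Bool.if uniformCluster M K (kept I) ∧ withinBudget M K (kept I) then yesInstance else noInstance))
    ≡⟨ if-float encodeInstance (small M K (kept I)) ⟨
  encodeInstance (reduce I) ∎
  where
  open ≡.≡-Reasoning
  E  = edges (input I)
  M  = closed E
  k  = param I
  K  = k + k
  m  = encodeGraph (input I)
  kT = encodeℕ k
  κ  = encodeℕ K

  answer : Tree → Tree → Tree
  answer = answerT (encodeInstance yesInstance) (encodeInstance noInstance) m kT

-- Running time and kernel size

polynomialTime : ∀ {A B : Set} (encodeA : A → Tree) (encodeB : B → Tree) g {f} → PolyTime f →
                 (∀ a → f (encodeA a) ≡ encodeB (g a)) → PolynomialTime encodeA encodeB g
polynomialTime encodeA encodeB g F f-encode with c , d , cost≤ ← ⟦⟧-monomial (cost F) = prog F , c , d , λ a →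
  let t , F⇓ , t≤ = runs F (encodeA a)
  in t , subst (λ y → prog F ⊢ encodeA a ⇓ y ∣ t) (f-encode a) F⇓
       , ≤-trans t≤ (cost≤ (size (encodeA a)) (size≥1 (encodeA a)))

reduce-polynomial-time : PolynomialTime encodeInstance encodeInstance reduce
reduce-polynomial-time = polynomialTime encodeInstance encodeInstance reduce
                           (kernelP (encodeInstance yesInstance) (encodeInstance noInstance))
                           kernelT-encode

-- The bound K * K + 2K with K = 2k for the surviving graph, plus 6 for the vertices of the constant
-- no-instance.
kernelSize : ℕ → ℕ
kernelSize k = (k + k) * (k + k) + ((k + k) + (k + k)) + 6

kernelSize-quadratic : kernelSize ∈O (λ k → k ^ 2)
-- The size is 4k² + 8k - 4k + 6 = 4k² + 4k + 6, and from k = 1 on each term is at most its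
-- coefficient times k²: 14 = 4 + 4 + 6.
kernelSize-quadratic = 14 , 1 , λ k 1≤k → let open ≤-Reasoning in begin
  (k + k) * (k + k) + ((k + k) + (k + k)) + 6
    ≡⟨ solve 1 (λ k → (k :+ k) :* (k :+ k) :+ ((k :+ k) :+ (k :+ k)) :+ con 6
                   := con 4 :* (k :* k) :+ con 4 :* k :* con 1 :+ con 6 :* con 1 :* con 1) refl k ⟩
  4 * (k * k) + 4 * k * 1 + 6 * 1 * 1
    ≤⟨ +-mono-≤ (+-monoʳ-≤ (4 * (k * k)) (*-monoʳ-≤ (4 * k) 1≤k)) (*-mono-≤ (*-monoʳ-≤ 6 1≤k) 1≤k) ⟩
  4 * (k * k) + 4 * k * k + 6 * k * k
    ≡⟨ solve 1 (λ k → con 4 :* (k :* k) :+ con 4 :* k :* k :+ con 6 :* k :* k := con 14 :* (k :* (k :* con 1))) refl k ⟩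
  14 * k ^ 2 ∎
  where open +-*-Solver

theorem44 : ∃[ f ] f ∈O (λ k → k ^ 2) × Kernel UCEE f
theorem44 = kernelSize , kernelSize-quadratic , record
  { reduce          = reduce
  ; polynomial-time = reduce-polynomial-time
  ; correct         = reduce-correct
  ; order-bound     = reduce-order
  ; g               = λ k → k
  ; g-computable    = copy , λ n → _ , ⇓copy
  ; param-bound     = reduce-param
  }
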